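{- For all $n\ge2$, $\mathsf{depth}^{\mathsf u}_2(\mathsf{MUX}_n)=2n+2$; that is, the minimal depth of a hazard-free De Morgan formula of alternation depth $2$ computing $\mathsf{MUX}_n$ is exactly $2n+2$.
   Context: $\mathsf{MUX}_n\colon\{0,1\}^{n+2^n}\to\{0,1\}$ is $\mathsf{MUX}_n(s_1,\dots,s_n,x_0,\dots,x_{2^n-1})=x_{\mathrm{bin}(s_1,\dots,s_n)}$, where $\mathrm{bin}(s_1,\dots,s_n)$ is the natural number with binary representation $s_1s_2\cdots s_n$. Three-valued logic: let $\mathsf u$ be a third symbol, thought of as $\tfrac12$, so $0<\mathsf u<1$; $x\wedge y=\min(x,y)$, $x\vee y=\max(x,y)$, $\neg x=1-x$ on $\{0,\mathsf u,1\}$. A resolution of $\alpha\in\{0,\mathsf u,1\}^m$ is a string $a\in\{0,1\}^m$ with $a_i=\alpha_i$ whenever $\alpha_i\ne\mathsf u$. The hazard-free extension $\tilde f$ of $f\colon\{0,1\}^m\to\{0,1\}$ is: $\tilde f(\alpha)=c\in\{0,1\}$ if $f(a)=c$ for all resolutions $a$ of $\alpha$, and $\tilde f(\alpha)=\mathsf u$ otherwise. A De Morgan formula is a binary tree whose internal nodes are labeled $\vee$ or $\wedge$ (fan-in two) and whose leaves are labeled by literals (a variable or its negation), evaluated on $\{0,\mathsf u,1\}$-inputs by the rules above. Depth is the length (number of edges) of the longest root-to-leaf path. The alternation depth of a formula is one plus the maximum, over root-to-leaf paths, of the number of changes of gate type ($\vee$ versus $\wedge$) in the sequence of gates along the path.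 A formula $F$ computing $f$ is hazard-free if $F(\alpha)=\tilde f(\alpha)$ for all $\alpha\in\{0,\mathsf u,1\}^m$. -}

module Defs where

open import Data.Bool using (Bool; true; false; if_then_else_)
import Data.Bool.Properties as Bool
open import Data.Fin using (Fin; zero; suc; combine)
import Data.Fin.Properties as Fin
open import Data.List as List using (List; []; _∷_; _++_; length)
open import Data.List.Extrema using (max)
open import Data.Nat using (ℕ; zero; suc; _+_; _*_; _^_; _≤_)
open import Data.Nat.Properties using (≤-totalOrder)
open import Data.Product using (_×_; _,_; ∃-syntax)
open import Data.Vec as Vec using (Vec; []; _∷_; lookup)
open import Relation.Binary.Definitions using (DecidableEquality)
open import Relation.Binary.PropositionalEquality using (_≡_; _≢_; refl)
open import Relation.Nullary using (Dec; yes; no; does)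
open import Relation.Nullary.Decidable using (¬?; _→-dec_; _×-dec_; map′)
open import Relation.Unary using (Pred; Decidable)
open import Level using (0ℓ)

-- 𝟎 < 𝐮 < 𝟏; _∧_ and _∨_ are minimum and maximum for this order.

data 𝕋 : Set where
  𝟎 𝐮 𝟏 : 𝕋

infixr 6 _∧_
infixr 5 _∨_

_∧_ : 𝕋 → 𝕋 → 𝕋
𝟎 ∧ _ = 𝟎
𝐮 ∧ 𝟎 = 𝟎
𝐮 ∧ 𝐮 = 𝐮
𝐮 ∧ 𝟏 = 𝐮
𝟏 ∧ y = y

_∨_ : 𝕋 → 𝕋 → 𝕋
𝟎 ∨ y = y
𝐮 ∨ 𝟎 = 𝐮
𝐮 ∨ 𝐮 = 𝐮
𝐮 ∨ 𝟏 = 𝟏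
𝟏 ∨ _ = 𝟏

¬ᵗ_ : 𝕋 → 𝕋
¬ᵗ 𝟎 = 𝟏
¬ᵗ 𝐮 = 𝐮
¬ᵗ 𝟏 = 𝟎

_≟ᵗ_ : DecidableEquality 𝕋
𝟎 ≟ᵗ 𝟎 = yes refl
𝟎 ≟ᵗ 𝐮 = no λ ()
𝟎 ≟ᵗ 𝟏 = no λ ()
𝐮 ≟ᵗ 𝟎 = no λ ()
𝐮 ≟ᵗ 𝐮 = yes refl
𝐮 ≟ᵗ 𝟏 = no λ ()
𝟏 ≟ᵗ 𝟎 = no λ ()
𝟏 ≟ᵗ 𝐮 = no λ ()
𝟏 ≟ᵗ 𝟏 = yes refl

⌜_⌝ : Bool → 𝕋
⌜ false ⌝ = 𝟎
⌜ true ⌝ = 𝟏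

Resolution : ∀ {m} → Vec 𝕋 m → Vec Bool m → Set
Resolution α a = ∀ i → lookup α i ≢ 𝐮 → ⌜ lookup a i ⌝ ≡ lookup α i

resolution? : ∀ {m} (α : Vec 𝕋 m) → Decidable (Resolution α)
resolution? α a =
  Fin.all? λ i → ¬? (lookup α i ≟ᵗ 𝐮) →-dec (⌜ lookup a i ⌝ ≟ᵗ lookup α i)

ConstantOn : ∀ {m} → (Vec Bool m → Bool) → Vec 𝕋 m → Bool → Set
ConstantOn f α c = ∀ a → Resolution α a → f a ≡ c

allBits? : ∀ {m} {P : Pred (Vec Bool m) 0ℓ} → Decidable P → Dec (∀ a → P a)
allBits? {zero}  P? = map′ (λ { p [] → p }) (λ h → h []) (P? [])
allBits? {suc m} P? =
  map′ (λ { (p , q) (false ∷ a) → p a ; (p , q) (true ∷ a) → q a })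
       (λ h → (λ a → h (false ∷ a)) , (λ a → h (true ∷ a)))
       (allBits? (λ a → P? (false ∷ a)) ×-dec allBits? (λ a → P? (true ∷ a)))

constantOn? : ∀ {m} (f : Vec Bool m → Bool) (α : Vec 𝕋 m) →
              Decidable (ConstantOn f α)
constantOn? f α c = allBits? λ a → resolution? α a →-dec (f a Bool.≟ c)

-- The hazard-free extension of f.  The order of the two tests is immaterial:
-- every α has a resolution, so f cannot be constantly 0 and constantly 1.
hfExt : ∀ {m} → (Vec Bool m → Bool) → Vec 𝕋 m → 𝕋
hfExt f α =
  if does (constantOn? f α false) then 𝟎
  else if does (constantOn? f α true) then 𝟏
  else 𝐮

data Literal (m : ℕ) : Set where
  pos neg : Fin m → Literal m

data Gate : Set where
  and or : Gate

_≟ᵍ_ : DecidableEquality Gate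
and ≟ᵍ and = yes refl
and ≟ᵍ or  = no λ ()
or  ≟ᵍ and = no λ ()
or  ≟ᵍ or  = yes refl

data Formula (m : ℕ) : Set where
  leaf : Literal m → Formula m
  node : Gate → Formula m → Formula m → Formula m

evalLiteral : ∀ {m} → Literal m → Vec 𝕋 m → 𝕋
evalLiteral (pos i) α = lookup α i
evalLiteral (neg i) α = ¬ᵗ lookup α i

evalGate : Gate → 𝕋 → 𝕋 → 𝕋
evalGate and = _∧_
evalGate or  = _∨_

eval : ∀ {m} → Formula m → Vec 𝕋 m → 𝕋
eval (leaf l)       α = evalLiteral l α
eval (node g F G) α = evalGate g (eval F α) (eval G α)

-- The root-to-leaf paths, each recorded as its sequence of gates from the root
-- down.  The leaf is not recorded, so the length of the list is the number of
-- edges of the path.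
paths : ∀ {m} → Formula m → List (List Gate)
paths (leaf _)     = [] ∷ []
paths (node g F G) = List.map (g ∷_) (paths F ++ paths G)

changes : List Gate → ℕ
changes []               = 0
changes (g ∷ [])         = 0
changes (g ∷ gs@(h ∷ _)) = (if does (g ≟ᵍ h) then 0 else 1) + changes gs

depth : ∀ {m} → Formula m → ℕ
depth F = max ≤-totalOrder 0 (List.map length (paths F))

altDepth : ∀ {m} → Formula m → ℕ
altDepth F = 1 + max ≤-totalOrder 0 (List.map changes (paths F))

Computes : ∀ {m} → Formula m → (Vec Bool m → Bool) → Set
Computes F f = ∀ a → eval F (Vec.map ⌜_⌝ a) ≡ ⌜ f a ⌝

HazardFree : ∀ {m} → Formula m → (Vec Bool m → Bool) → Set
HazardFree F f = ∀ α → eval F α ≡ hfExt f α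

Admissible : ∀ {m} → ℕ → (Vec Bool m → Bool) → Formula m → Set
Admissible k f F = Computes F f × HazardFree F f × altDepth F ≡ k

-- depthᵘₖ(f) = d, that is, d is the minimum of the depths of the hazard-free
-- formulas of alternation depth k computing f (in particular, it is attained).
Depthᵘ : ∀ {m} → ℕ → (Vec Bool m → Bool) → ℕ → Set
Depthᵘ {m} k f d =
  (∃[ F ] Admissible k f F × depth F ≡ d) ×
  (∀ (F : Formula m) → Admissible k f F → d ≤ depth F)

bit : Bool → Fin 2
bit false = zero
bit true  = suc zero

-- s₁ is the most significant digit: combine i j has value 2 ^ n * i + j for
-- i : Fin 2 and j : Fin (2 ^ n).
bin : ∀ {n} → Vec Bool n → Fin (2 ^ n)
bin []      = zero
bin (s ∷ t) = combine (bit s) (bin t)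

MUX : ∀ n → Vec Bool (n + 2 ^ n) → Bool
MUX n v = lookup (Vec.drop n v) (bin (Vec.take n v))

{-# OPTIONS --safe #-}

-- Lower bound.  Let g be the top gate of a two-level hazard-free formula.  For
-- α ∈ {0,u,1}ⁿ feed the selectors with α and set x_{bin a} to the absorbing
-- value of g for the resolutions a of α, all other data to u.  Any term (maximal
-- subformula without the gate g at the root) that takes this value contains the
-- n − k fixed selectors of α and its 2ᵏ data variables, k being the number of u's
-- in α, and determines the values of its variables.  So distinct α need distinct
-- terms, of size at least n − k + 2ᵏ, and Kraft's inequality gives 2^depth ≥ Σ_α 2^⌈log₂(n − k + 2ᵏ)⌉ > 2^(2n+1).
--
-- Upper bound.  The disjunction of all 3ⁿ prime implicants is hazard-free.  The
-- term of α fits in a conjunction tree of height h with 2ʰ ≤ 2(n − k + 2ᵏ − 1),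
-- these powers sum to at most 2^(2n+2), and powers of two pack perfectly into a
-- disjunction tree (the converse of Kraft's inequality).

module Submission where

open import Defs
open import Data.Bool using (Bool; true; false; not; if_then_else_)
open import Data.Empty using (⊥)
open import Data.Fin as Fin using (Fin; zero; suc; remQuot; _↑ˡ_; _↑ʳ_)
import Data.Fin.Properties as Fin
open import Data.List as List using (List; []; _∷_; _++_; length; map; foldr; cartesianProductWith)
import Data.List.Properties as List
open import Data.List.Extrema using (max≤v⁺; xs≤max)
import Data.List.Membership.DecPropositional as DecMembership
open import Data.List.Membership.Propositional using (_∈_; _∉_)
open import Data.List.Membership.Propositional.Properties
open import Data.List.Relation.Unary.All as All using (All; []; _∷_)
import Data.List.Relation.Unary.All.Properties as All
open import Data.List.Relation.Unary.AllPairs using ([]; _∷_)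
open import Data.List.Relation.Unary.Any as Any using (Any; here; there)
open import Data.List.Relation.Unary.Any.Properties using (lookup-index)
open import Data.List.Relation.Unary.Unique.Propositional using (Unique)
import Data.List.Relation.Unary.Unique.Propositional.Properties as Unique
open import Data.Maybe using (Maybe; just; nothing)
open import Data.Nat
open import Data.Nat.ListAction using (sum)
open import Data.Nat.ListAction.Properties using (sum-++)
open import Data.Nat.Properties
open import Data.Nat.Tactic.RingSolver using (solve-∀)
open import Data.Product using (_×_; _,_; proj₁; proj₂; ∃-syntax)
open import Data.Sum using (_⊎_; inj₁; inj₂)
open import Data.Vec as Vec using (Vec; []; _∷_; lookup; _[_]≔_)
import Data.Vec.Properties as Vec
open import Function using (_∘_; case_of_)
open import Relation.Binary.PropositionalEquality
open import Relation.Nullary using (¬_; Dec; yes; no; does; contradiction)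
open import Relation.Nullary.Decidable using (dec-true; from-yes; ¬?; _×-dec_)

private variable
  m n : ℕ
  F G : Formula m

-- Two-level formulas

dual : Gate → Gate
dual and = or
dual or  = and

absorbing : Gate → Bool
absorbing and = false
absorbing or  = true

data Pure (g : Gate) {m : ℕ} : Formula m → Set where
  leaf : ∀ {l} → Pure g (leaf l)
  node : Pure g F → Pure g G → Pure g (node g F G)

-- The top layer may be empty and a term may be a single leaf, so this describes alternation depth
-- at most 2. That the depth is exactly 2 follows later from `hazardFree⇒¬pure`.
data TwoLevel (g : Gate) {m : ℕ} : Formula m → Set where
  term : Pure (dual g) F → TwoLevel g F
  node : TwoLevel g F → TwoLevel g G → TwoLevel g (node g F G)

-- Structural counterpart of `depth`, which is a maximum over a list of paths; inductions on
-- formulas use this form and `depth≡height` translates.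
height : Formula m → ℕ
height (leaf _)     = 0
height (node _ F G) = suc (height F ⊔ height G)

path-left : ∀ (g : Gate) (F G : Formula m) {p} → p ∈ paths F → g ∷ p ∈ paths (node g F G)
path-left g F G p∈ = ∈-map⁺ (g ∷_) (∈-++⁺ˡ p∈)

path-right : ∀ (g : Gate) (F G : Formula m) {p} → p ∈ paths G → g ∷ p ∈ paths (node g F G)
path-right g F G p∈ = ∈-map⁺ (g ∷_) (∈-++⁺ʳ (paths F) p∈)

path-node : ∀ (g : Gate) (F G : Formula m) {q} → q ∈ paths (node g F G) →
            ∃[ p ] q ≡ g ∷ p × (p ∈ paths F ⊎ p ∈ paths G)
path-node g F G q∈ with ∈-map⁻ (g ∷_) q∈
... | p , p∈ , q≡ = p , q≡ , ∈-++⁻ (paths F) p∈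

longest-path : (F : Formula m) → ∃[ p ] p ∈ paths F × length p ≡ height F
longest-path (leaf _) = [] , here refl , refl
longest-path (node g F G) with longest-path F | longest-path G | ≤-total (height F) (height G)
... | _ | p , p∈ , eq | inj₁ F≤G =
  g ∷ p , path-right g F G p∈ , cong suc (trans eq (sym (m≤n⇒m⊔n≡n F≤G)))
... | p , p∈ , eq | _ | inj₂ G≤F =
  g ∷ p , path-left g F G p∈ , cong suc (trans eq (sym (m≥n⇒m⊔n≡m G≤F)))

path≤height : (F : Formula m) → ∀ {p} → p ∈ paths F → length p ≤ height F
path≤height (leaf _) (here refl) = z≤n
path≤height (node g F G) q∈ with path-node g F G q∈
... | p , refl , inj₁ p∈ = s≤s (≤-trans (path≤height F p∈) (m≤m⊔n _ _))
... | p , refl , inj₂ p∈ = s≤s (≤-trans (path≤height G p∈) (m≤n⊔m _ _))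

depth≡height : (F : Formula m) → depth F ≡ height F
depth≡height F = ≤-antisym
  (max≤v⁺ ≤-totalOrder z≤n (All.map⁺ (All.tabulate (path≤height F))))
  (let p , p∈ , eq = longest-path F in
   subst (_≤ depth F) eq (All.lookup (All.map⁻ (xs≤max ≤-totalOrder 0 _)) p∈))

changes≤altDepth : (F : Formula m) → ∀ {p} → p ∈ paths F → suc (changes p) ≤ altDepth F
changes≤altDepth F p∈ = s≤s (All.lookup (All.map⁻ (xs≤max ≤-totalOrder 0 (map changes (paths F)))) p∈)

altDepth≤ : (F : Formula m) → ∀ {k} → (∀ {p} → p ∈ paths F → changes p ≤ k) → altDepth F ≤ suc k
altDepth≤ F h = s≤s (max≤v⁺ ≤-totalOrder z≤n (All.map⁺ (All.tabulate h)))

same-or-dual : ∀ g h → g ≡ h ⊎ h ≡ dual g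
same-or-dual and and = inj₁ refl
same-or-dual and or  = inj₂ refl
same-or-dual or  and = inj₂ refl
same-or-dual or  or  = inj₁ refl

changes-same : ∀ g p → changes (g ∷ g ∷ p) ≡ changes (g ∷ p)
changes-same and _ = refl
changes-same or  _ = refl

changes-dual : ∀ g p → changes (g ∷ dual g ∷ p) ≡ suc (changes (dual g ∷ p))
changes-dual and _ = refl
changes-dual or  _ = refl

changes-∷ : ∀ g p → changes p ≤ changes (g ∷ p)
changes-∷ g []      = z≤n
changes-∷ g (h ∷ p) = m≤n+m _ (if does (g ≟ᵍ h) then 0 else 1)

-- Prefixing `g` to every path makes a root gate other than `g` count as a change, so the hypothesis
-- remembers the gate of the enclosing layer.
pure-from-paths : ∀ g (F : Formula m) → (∀ {p} → p ∈ paths F → changes (g ∷ p) ≤ 0) → Pure g F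
pure-from-paths g (leaf _) _ = leaf
pure-from-paths g (node h F G) flat with same-or-dual g h
... | inj₁ refl = node
  (pure-from-paths g F λ {p} p∈ → subst (_≤ 0) (changes-same g p) (flat (path-left g F G p∈)))
  (pure-from-paths g G λ {p} p∈ → subst (_≤ 0) (changes-same g p) (flat (path-right g F G p∈)))
-- Any path exhibits the change at the root; `longest-path` supplies one.
... | inj₂ refl = contradiction
  (flat (path-left (dual g) F G (proj₁ (proj₂ (longest-path F)))))
  (subst (λ c → ¬ c ≤ 0) (sym (changes-dual g (proj₁ (longest-path F)))) λ ())

twoLevel-from-paths : ∀ g (F : Formula m) → (∀ {p} → p ∈ paths F → changes (g ∷ p) ≤ 1) → TwoLevel g F
twoLevel-from-paths g (leaf _) _ = term leaf
twoLevel-from-paths g (node h F G) flat with same-or-dual g h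
... | inj₁ refl = node
  (twoLevel-from-paths g F λ {p} p∈ → subst (_≤ 1) (changes-same g p) (flat (path-left g F G p∈)))
  (twoLevel-from-paths g G λ {p} p∈ → subst (_≤ 1) (changes-same g p) (flat (path-right g F G p∈)))
... | inj₂ refl = term (node
  (pure-from-paths (dual g) F λ {p} p∈ →
    s≤s⁻¹ (subst (_≤ 1) (changes-dual g p) (flat (path-left (dual g) F G p∈))))
  (pure-from-paths (dual g) G λ {p} p∈ →
    s≤s⁻¹ (subst (_≤ 1) (changes-dual g p) (flat (path-right (dual g) F G p∈)))))

altDepth-1-pure : (F : Formula m) → altDepth F ≤ 1 → ∃[ g ] Pure g F
altDepth-1-pure (leaf _)     _ = and , leaf
altDepth-1-pure (node g F G) d = g , node
  (pure-from-paths g F λ p∈ → s≤s⁻¹ (≤-trans (changes≤altDepth (node g F G) (path-left g F G p∈)) d))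
  (pure-from-paths g G λ p∈ → s≤s⁻¹ (≤-trans (changes≤altDepth (node g F G) (path-right g F G p∈)) d))

altDepth-2-twoLevel : (F : Formula m) → altDepth F ≤ 2 → ∃[ g ] TwoLevel g F
altDepth-2-twoLevel (leaf _)     _ = and , term leaf
altDepth-2-twoLevel (node g F G) d = g , node
  (twoLevel-from-paths g F λ p∈ → s≤s⁻¹ (≤-trans (changes≤altDepth (node g F G) (path-left g F G p∈)) d))
  (twoLevel-from-paths g G λ p∈ → s≤s⁻¹ (≤-trans (changes≤altDepth (node g F G) (path-right g F G p∈)) d))

pure-changes : ∀ {g} → Pure g F → ∀ {p} → p ∈ paths F → changes (g ∷ p) ≡ 0
pure-changes leaf (here refl) = refl
pure-changes {g = g} (node {F = F} {G = G} PF PG) q∈ with path-node g F G q∈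
... | p , refl , inj₁ p∈ = trans (changes-same g p) (pure-changes PF p∈)
... | p , refl , inj₂ p∈ = trans (changes-same g p) (pure-changes PG p∈)

changes-∷-≤ : ∀ g h p → changes (g ∷ p) ≤ suc (changes (h ∷ p))
changes-∷-≤ g h []      = z≤n
changes-∷-≤ g h (k ∷ p) =
  +-mono-≤ (switch≤1 (does (g ≟ᵍ k))) (m≤n+m (changes (k ∷ p)) (if does (h ≟ᵍ k) then 0 else 1))
  where
  switch≤1 : ∀ b → (if b then 0 else 1) ≤ 1
  switch≤1 true  = z≤n
  switch≤1 false = ≤-refl

twoLevel-changes : ∀ {g} → TwoLevel g F → ∀ {p} → p ∈ paths F → changes (g ∷ p) ≤ 1
twoLevel-changes {g = g} (term P) {p} p∈ =
  ≤-trans (changes-∷-≤ g (dual g) p) (s≤s (≤-reflexive (pure-changes P p∈)))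
twoLevel-changes {g = g} (node {F = F} {G = G} TF TG) q∈ with path-node g F G q∈
... | p , refl , inj₁ p∈ = subst (_≤ 1) (sym (changes-same g p)) (twoLevel-changes TF p∈)
... | p , refl , inj₂ p∈ = subst (_≤ 1) (sym (changes-same g p)) (twoLevel-changes TG p∈)

twoLevel-altDepth : ∀ {g} → TwoLevel g F → altDepth F ≤ 2
twoLevel-altDepth {F = F} T =
  altDepth≤ F λ {p} p∈ → ≤-trans (changes-∷ _ p) (twoLevel-changes T p∈)

-- Three-valued gates

valueOf : Gate → 𝕋
valueOf g = ⌜ absorbing g ⌝

⌜⌝-injective : ∀ {b c} → ⌜ b ⌝ ≡ ⌜ c ⌝ → b ≡ c
⌜⌝-injective {false} {false} _ = refl
⌜⌝-injective {true}  {true}  _ = refl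

⌜⌝≢𝐮 : ∀ b → ⌜ b ⌝ ≢ 𝐮
⌜⌝≢𝐮 false ()
⌜⌝≢𝐮 true  ()

¬ᵗ-injective : ∀ {x y} → ¬ᵗ x ≡ ¬ᵗ y → x ≡ y
¬ᵗ-injective {𝟎} {𝟎} _ = refl
¬ᵗ-injective {𝐮} {𝐮} _ = refl
¬ᵗ-injective {𝟏} {𝟏} _ = refl

-- The value `𝐮` is what remains when neither Boolean value is taken, so `eval` and `hfExt` need to
-- be compared only where one of them is Boolean.
Boolean-ext : ∀ {x y} → (∀ c → x ≡ ⌜ c ⌝ → y ≡ ⌜ c ⌝) → (∀ c → y ≡ ⌜ c ⌝ → x ≡ ⌜ c ⌝) → x ≡ y
Boolean-ext {𝟎}     h k = sym (h false refl)
Boolean-ext {𝟏}     h k = sym (h true refl)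
Boolean-ext {𝐮} {𝟎} h k = k false refl
Boolean-ext {𝐮} {𝐮} h k = refl
Boolean-ext {𝐮} {𝟏} h k = k true refl

gate-absorb⁻ : ∀ g x y → evalGate g x y ≡ valueOf g → x ≡ valueOf g ⊎ y ≡ valueOf g
gate-absorb⁻ and 𝟎 _ _ = inj₁ refl
gate-absorb⁻ and 𝐮 𝟎 _ = inj₂ refl
gate-absorb⁻ and 𝟏 _ e = inj₂ e
gate-absorb⁻ or  𝟎 _ e = inj₂ e
gate-absorb⁻ or  𝐮 𝟏 _ = inj₂ refl
gate-absorb⁻ or  𝟏 _ _ = inj₁ refl

gate-absorbˡ : ∀ g x y → x ≡ valueOf g → evalGate g x y ≡ valueOf g
gate-absorbˡ and _ _ refl = refl
gate-absorbˡ or  _ _ refl = refl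

gate-absorbʳ : ∀ g x y → y ≡ valueOf g → evalGate g x y ≡ valueOf g
gate-absorbʳ and 𝟎 _ refl = refl
gate-absorbʳ and 𝐮 _ refl = refl
gate-absorbʳ and 𝟏 _ refl = refl
gate-absorbʳ or  𝟎 _ refl = refl
gate-absorbʳ or  𝐮 _ refl = refl
gate-absorbʳ or  𝟏 _ refl = refl

gate-neutral⁻ : ∀ g x y → evalGate (dual g) x y ≡ valueOf g → x ≡ valueOf g × y ≡ valueOf g
gate-neutral⁻ or  𝟏 _ e = refl , e
gate-neutral⁻ or  𝐮 𝟎 ()
gate-neutral⁻ or  𝐮 𝐮 ()
gate-neutral⁻ or  𝐮 𝟏 ()
gate-neutral⁻ and 𝟎 _ e = refl , e
gate-neutral⁻ and 𝐮 𝟎 ()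
gate-neutral⁻ and 𝐮 𝐮 ()
gate-neutral⁻ and 𝐮 𝟏 ()

-- The hazard-free extension of MUX

fill : Bool → 𝕋 → Bool
fill d 𝟎 = false
fill d 𝐮 = d
fill d 𝟏 = true

fill-known : ∀ d t → t ≢ 𝐮 → ⌜ fill d t ⌝ ≡ t
fill-known d 𝟎 _ = refl
fill-known d 𝐮 t≢𝐮 = contradiction refl t≢𝐮
fill-known d 𝟏 _ = refl

-- Filling with the opposite bit yields `c` only where `c` already stood.
fill-not : ∀ c t → fill (not c) t ≡ c → t ≡ ⌜ c ⌝
fill-not false 𝟎 _ = refl
fill-not true  𝟏 _ = refl

fill-Resolution : ∀ d (α : Vec 𝕋 m) → Resolution α (Vec.map (fill d) α)
fill-Resolution d α i α≢𝐮 =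
  trans (cong ⌜_⌝ (Vec.lookup-map i (fill d) α)) (fill-known d (lookup α i) α≢𝐮)

hfExt⁺ : ∀ (f : Vec Bool m → Bool) α c → ConstantOn f α c → hfExt f α ≡ ⌜ c ⌝
hfExt⁺ f α c const with constantOn? f α false | constantOn? f α true | c
... | yes _ | _     | false = refl
... | no ¬p | _     | false = contradiction const ¬p
... | no _  | yes _ | true  = refl
... | no _  | no ¬p | true  = contradiction const ¬p
-- Filling gives a resolution of `α`, on which `f` would be both true and false.
... | yes p | _     | true  =
  contradiction (trans (sym (const a (fill-Resolution true α))) (p a (fill-Resolution true α))) λ ()
  where a = Vec.map (fill true) α

hfExt⁻ : ∀ (f : Vec Bool m → Bool) α c → hfExt f α ≡ ⌜ c ⌝ → ConstantOn f α c
hfExt⁻ f α c with constantOn? f α false | constantOn? f α true | c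
... | yes p | _     | false = λ _ → p
... | yes _ | _     | true  = λ ()
... | no _  | yes _ | false = λ ()
... | no _  | yes p | true  = λ _ → p
... | no _  | no _  | false = λ ()
... | no _  | no _  | true  = λ ()

++-Resolution : ∀ {α : Vec 𝕋 m} {x : Vec 𝕋 n} {a y} → Resolution α a → Resolution x y →
                Resolution (α Vec.++ x) (a Vec.++ y)
++-Resolution {m} {n} {α} {x} {a} {y} ra ry i ≢𝐮 with Fin.splitAt m i in eq
... | inj₁ j with refl ← Fin.splitAt⁻¹-↑ˡ eq
    rewrite Vec.lookup-++ˡ α x j | Vec.lookup-++ˡ a y j = ra j ≢𝐮
... | inj₂ j with refl ← Fin.splitAt⁻¹-↑ʳ {m} eq
    rewrite Vec.lookup-++ʳ α x j | Vec.lookup-++ʳ a y j = ry j ≢𝐮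

++-Resolutionˡ : ∀ {α : Vec 𝕋 m} {x : Vec 𝕋 n} {a y} → Resolution (α Vec.++ x) (a Vec.++ y) → Resolution α a
++-Resolutionˡ {n = n} {α} {x} {a} {y} r i α≢𝐮 =
  trans (cong ⌜_⌝ (sym (Vec.lookup-++ˡ a y i)))
 (trans (r (i ↑ˡ n) (α≢𝐮 ∘ trans (sym (Vec.lookup-++ˡ α x i)))) (Vec.lookup-++ˡ α x i))

++-Resolutionʳ : ∀ {α : Vec 𝕋 m} {x : Vec 𝕋 n} {a y} → Resolution (α Vec.++ x) (a Vec.++ y) → Resolution x y
++-Resolutionʳ {m = m} {α = α} {x} {a} {y} r i x≢𝐮 =
  trans (cong ⌜_⌝ (sym (Vec.lookup-++ʳ a y i)))
 (trans (r (m ↑ʳ i) (x≢𝐮 ∘ trans (sym (Vec.lookup-++ʳ α x i)))) (Vec.lookup-++ʳ α x i))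

take-++ : ∀ {A : Set} (xs : Vec A m) (ys : Vec A n) → Vec.take m (xs Vec.++ ys) ≡ xs
take-++ []       ys = refl
take-++ (x ∷ xs) ys = cong (x ∷_) (take-++ xs ys)

drop-++ : ∀ {A : Set} (xs : Vec A m) (ys : Vec A n) → Vec.drop m (xs Vec.++ ys) ≡ ys
drop-++ []       ys = refl
drop-++ (x ∷ xs) ys = drop-++ xs ys

MUX-++ : ∀ n (a : Vec Bool n) y → MUX n (a Vec.++ y) ≡ lookup y (bin a)
MUX-++ n a y = cong₂ lookup (drop-++ a y) (cong bin (take-++ a y))

-- The worst resolution fills every unknown data input with `not c`; an addressed input that still
-- reads `c` was known. With the converse `ConstantOn-MUX⁺`, constancy of `MUX` is a condition on
-- the addressed data alone.
ConstantOn-MUX⁻ : ∀ n (α : Vec 𝕋 n) x c → ConstantOn (MUX n) (α Vec.++ x) c →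
                  ∀ a → Resolution α a → lookup x (bin a) ≡ ⌜ c ⌝
ConstantOn-MUX⁻ n α x c const a ra = fill-not c (lookup x (bin a))
  (trans (sym (Vec.lookup-map (bin a) (fill (not c)) x))
  (trans (sym (MUX-++ n a y))
         (const (a Vec.++ y) (++-Resolution {α = α} {x} {a} {y} ra (fill-Resolution (not c) x)))))
  where y = Vec.map (fill (not c)) x

ConstantOn-MUX⁺ : ∀ n (α : Vec 𝕋 n) x c → (∀ a → Resolution α a → lookup x (bin a) ≡ ⌜ c ⌝) →
                  ConstantOn (MUX n) (α Vec.++ x) c
ConstantOn-MUX⁺ n α x c sel v rv with Vec.take n v | Vec.drop n v | Vec.take++drop≡id n v
... | a | y | refl = ⌜⌝-injective
  (trans (++-Resolutionʳ {α = α} {x} {a} {y} rv (bin a) (subst (_≢ 𝐮) (sym x-bin) (⌜⌝≢𝐮 c))) x-bin)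
  where x-bin = sel a (++-Resolutionˡ {α = α} {x} {a} {y} rv)

unbit : Fin 2 → Bool
unbit zero       = false
unbit (suc zero) = true

-- A left inverse of `bin`: it gives injectivity, and lets `data-inputs` be tabulated by index.
unbin : Fin (2 ^ n) → Vec Bool n
unbin {zero}  _ = []
unbin {suc n} j = unbit (proj₁ (remQuot {2} (2 ^ n) j)) ∷ unbin (proj₂ (remQuot {2} (2 ^ n) j))

unbit-bit : ∀ s → unbit (bit s) ≡ s
unbit-bit false = refl
unbit-bit true  = refl

unbin-bin : (a : Vec Bool n) → unbin (bin a) ≡ a
unbin-bin []      = refl
unbin-bin (s ∷ a) = cong₂ _∷_
  (trans (cong (unbit ∘ proj₁) split) (unbit-bit s))
  (trans (cong (unbin ∘ proj₂) split) (unbin-bin a))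
  where split = Fin.remQuot-combine (bit s) (bin a)

bin-injective : {a b : Vec Bool n} → bin a ≡ bin b → a ≡ b
bin-injective {a = a} {b} e = trans (sym (unbin-bin a)) (trans (cong unbin e) (unbin-bin b))

-- Critical variables of a selector pattern

options : 𝕋 → List Bool
options 𝟎 = false ∷ []
options 𝐮 = false ∷ true ∷ []
options 𝟏 = true ∷ []

resolutions : Vec 𝕋 n → List (Vec Bool n)
resolutions []      = [] ∷ []
resolutions (t ∷ α) = cartesianProductWith _∷_ (options t) (resolutions α)

fixed : Vec 𝕋 n → List (Fin n)
fixed []      = []
fixed (𝟎 ∷ α) = zero ∷ map suc (fixed α)
fixed (𝐮 ∷ α) = map suc (fixed α)
fixed (𝟏 ∷ α) = zero ∷ map suc (fixed α)

options⁺ : ∀ t b → (t ≢ 𝐮 → ⌜ b ⌝ ≡ t) → b ∈ options t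
options⁺ 𝟎 b     h with refl ← ⌜⌝-injective {b} {false} (h λ ()) = here refl
options⁺ 𝐮 false h = here refl
options⁺ 𝐮 true  h = there (here refl)
options⁺ 𝟏 b     h with refl ← ⌜⌝-injective {b} {true} (h λ ()) = here refl

options⁻ : ∀ t {b} → b ∈ options t → t ≢ 𝐮 → ⌜ b ⌝ ≡ t
options⁻ 𝟎 (here refl) _   = refl
options⁻ 𝐮 _           𝐮≢𝐮 = contradiction refl 𝐮≢𝐮
options⁻ 𝟏 (here refl) _   = refl

resolutions⁺ : ∀ (α : Vec 𝕋 n) {a} → Resolution α a → a ∈ resolutions α
resolutions⁺ []      {[]}    _ = here refl
resolutions⁺ (t ∷ α) {b ∷ a} r =
  ∈-cartesianProductWith⁺ _∷_ (options⁺ t b (r zero)) (resolutions⁺ α (r ∘ suc))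

resolutions⁻ : ∀ (α : Vec 𝕋 n) {a} → a ∈ resolutions α → Resolution α a
resolutions⁻ (t ∷ α) a∈ i ≢𝐮 with ∈-cartesianProductWith⁻ _∷_ (options t) (resolutions α) a∈
resolutions⁻ (t ∷ α) a∈ zero    ≢𝐮 | _ , _ , b∈ , _  , refl = options⁻ t b∈ ≢𝐮
resolutions⁻ (t ∷ α) a∈ (suc i) ≢𝐮 | _ , _ , _  , a∈′ , refl = resolutions⁻ α a∈′ i ≢𝐮

fixed⁺ : ∀ (α : Vec 𝕋 n) {i} → lookup α i ≢ 𝐮 → i ∈ fixed α
fixed⁺ (𝟎 ∷ α) {zero}  _  = here refl
fixed⁺ (𝟎 ∷ α) {suc i} ≢𝐮 = there (∈-map⁺ suc (fixed⁺ α ≢𝐮))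
fixed⁺ (𝐮 ∷ α) {zero}  ≢𝐮 = contradiction refl ≢𝐮
fixed⁺ (𝐮 ∷ α) {suc i} ≢𝐮 = ∈-map⁺ suc (fixed⁺ α ≢𝐮)
fixed⁺ (𝟏 ∷ α) {zero}  _  = here refl
fixed⁺ (𝟏 ∷ α) {suc i} ≢𝐮 = there (∈-map⁺ suc (fixed⁺ α ≢𝐮))

fixed⁻ : ∀ (α : Vec 𝕋 n) {i} → i ∈ fixed α → lookup α i ≢ 𝐮
fixed⁻ (𝟎 ∷ α) (here refl) ()
fixed⁻ (𝟎 ∷ α) (there i∈) with ∈-map⁻ suc i∈
... | _ , j∈ , refl = fixed⁻ α j∈
fixed⁻ (𝐮 ∷ α) i∈ with ∈-map⁻ suc i∈
... | _ , j∈ , refl = fixed⁻ α j∈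
fixed⁻ (𝟏 ∷ α) (here refl) ()
fixed⁻ (𝟏 ∷ α) (there i∈) with ∈-map⁻ suc i∈
... | _ , j∈ , refl = fixed⁻ α j∈

options-unique : ∀ t → Unique (options t)
options-unique 𝟎 = [] ∷ []
options-unique 𝐮 = ((λ ()) ∷ []) ∷ [] ∷ []
options-unique 𝟏 = [] ∷ []

resolutions-unique : (α : Vec 𝕋 n) → Unique (resolutions α)
resolutions-unique []      = [] ∷ []
resolutions-unique (t ∷ α) =
  Unique.cartesianProductWith⁺ _∷_ Vec.∷-injective (options-unique t) (resolutions-unique α)

zero∷map-suc-unique : {is : List (Fin n)} → Unique is → Unique (zero ∷ map suc is)
zero∷map-suc-unique u = All.map⁺ (All.universal (λ _ ()) _) ∷ Unique.map⁺ Fin.suc-injective u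

fixed-unique : (α : Vec 𝕋 n) → Unique (fixed α)
fixed-unique []      = []
fixed-unique (𝟎 ∷ α) = zero∷map-suc-unique (fixed-unique α)
fixed-unique (𝐮 ∷ α) = Unique.map⁺ Fin.suc-injective (fixed-unique α)
fixed-unique (𝟏 ∷ α) = zero∷map-suc-unique (fixed-unique α)

-- The variables of the prime implicant of `MUX` that belongs to `α`.
critical : Vec 𝕋 n → List (Fin (n + 2 ^ n))
critical {n} α = map (_↑ˡ 2 ^ n) (fixed α) ++ map (λ a → n ↑ʳ bin a) (resolutions α)

critical-unique : (α : Vec 𝕋 n) → Unique (critical α)
critical-unique {n} α = Unique.++⁺
  (Unique.map⁺ (Fin.↑ˡ-injective (2 ^ n) _ _) (fixed-unique α))
  (Unique.map⁺ (bin-injective ∘ Fin.↑ʳ-injective n _ _) (resolutions-unique α))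
  λ (p , q) → disjoint p q
  where
  disjoint : ∀ {i} → i ∈ map (_↑ˡ 2 ^ n) (fixed α) → i ∈ map (λ a → n ↑ʳ bin a) (resolutions α) → ⊥
  disjoint p q with ∈-map⁻ (_↑ˡ 2 ^ n) p | ∈-map⁻ (λ a → n ↑ʳ bin a) q
  ... | j , _ , e | a , _ , e′
    with trans (sym (Fin.splitAt-↑ˡ n j (2 ^ n)))
        (trans (cong (Fin.splitAt n) (trans (sym e) e′)) (Fin.splitAt-↑ʳ n (2 ^ n) (bin a)))
  ... | ()

length-critical : (α : Vec 𝕋 n) → length (critical α) ≡ length (fixed α) + length (resolutions α)
length-critical {n} α = trans (List.length-++ (map (_↑ˡ 2 ^ n) (fixed α)))
  (cong₂ _+_ (List.length-map _ (fixed α)) (List.length-map _ (resolutions α)))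

-- Terms and the variables they must contain

variable-of : Literal m → Fin m
variable-of (pos i) = i
variable-of (neg i) = i

-- Repetitions are kept, one entry per leaf; an upper bound for the length is all that is required.
vars : Formula m → List (Fin m)
vars (leaf l)     = variable-of l ∷ []
vars (node _ F G) = vars F ++ vars G

2^-⊔ : ∀ a b → 2 ^ a + 2 ^ b ≤ 2 ^ suc (a ⊔ b)
2^-⊔ a b = +-mono-≤ (^-monoʳ-≤ 2 (m≤m⊔n a b))
  (≤-trans (^-monoʳ-≤ 2 (m≤n⊔m a b)) (m≤m+n (2 ^ (a ⊔ b)) 0))

length-vars≤ : (F : Formula m) → length (vars F) ≤ 2 ^ height F
length-vars≤ (leaf _)     = ≤-refl
length-vars≤ (node _ F G) = begin
  length (vars F ++ vars G)          ≡⟨ List.length-++ (vars F) ⟩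
  length (vars F) + length (vars G)  ≤⟨ +-mono-≤ (length-vars≤ F) (length-vars≤ G) ⟩
  2 ^ height F + 2 ^ height G        ≤⟨ 2^-⊔ (height F) (height G) ⟩
  2 ^ suc (height F ⊔ height G)      ∎
  where open ≤-Reasoning

eval-update : (F : Formula m) → ∀ {i} → i ∉ vars F → ∀ β t → eval F (β [ i ]≔ t) ≡ eval F β
eval-update (leaf (pos j)) i∉ β t = Vec.lookup∘update′ (λ e → i∉ (here (sym e))) β t
eval-update (leaf (neg j)) i∉ β t = cong ¬ᵗ_ (Vec.lookup∘update′ (λ e → i∉ (here (sym e))) β t)
eval-update (node g F G)   i∉ β t = cong₂ (evalGate g)
  (eval-update F (i∉ ∘ ∈-++⁺ˡ) β t) (eval-update G (i∉ ∘ ∈-++⁺ʳ (vars F)) β t)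

-- A tree of `dual g` gates reaches the value absorbing for `g` only if all its leaves do, and a
-- literal with a given value determines its variable.
pure-vars : ∀ {g} → Pure (dual g) F → ∀ {i β β′} → i ∈ vars F →
            eval F β ≡ valueOf g → eval F β′ ≡ valueOf g → lookup β i ≡ lookup β′ i
pure-vars (leaf {pos _}) (here refl) e e′ = trans e (sym e′)
pure-vars (leaf {neg _}) (here refl) e e′ = ¬ᵗ-injective (trans e (sym e′))
pure-vars {g = g} (node {F = F} {G = G} PF PG) {β = β} {β′} i∈ e e′
  with ∈-++⁻ (vars F) i∈ | gate-neutral⁻ g (eval F β) _ e | gate-neutral⁻ g (eval F β′) _ e′
... | inj₁ i∈F | eF , _ | eF′ , _ = pure-vars PF i∈F eF eF′
... | inj₂ i∈G | _ , eG | _ , eG′ = pure-vars PG i∈G eG eG′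

-- An implicant for `or` and an implicate for `and`, so that disjunctions of terms and conjunctions
-- of clauses are treated at once.
Implicant : ∀ n → Gate → Formula (n + 2 ^ n) → Set
Implicant n g F = ∀ β → eval F β ≡ valueOf g → ConstantOn (MUX n) β (absorbing g)

-- The least informative data for which `MUX` with selectors `α` is still constantly `absorbing g`.
data-inputs : Gate → Vec 𝕋 n → Vec 𝕋 (2 ^ n)
data-inputs g α = Vec.tabulate λ j → if does (resolution? α (unbin j)) then valueOf g else 𝐮

input : Gate → Vec 𝕋 n → Vec 𝕋 (n + 2 ^ n)
input g α = α Vec.++ data-inputs g α

lookup-data-inputs : ∀ g (α : Vec 𝕋 n) a →
  lookup (data-inputs g α) (bin a) ≡ (if does (resolution? α a) then valueOf g else 𝐮)
lookup-data-inputs g α a = trans (Vec.lookup∘tabulate _ (bin a))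
  (cong (λ b → if does (resolution? α b) then valueOf g else 𝐮) (unbin-bin a))

data-inputs⁻ : ∀ g (α : Vec 𝕋 n) a → lookup (data-inputs g α) (bin a) ≡ valueOf g → Resolution α a
data-inputs⁻ g α a e = from-if (resolution? α a) (trans (sym (lookup-data-inputs g α a)) e)
  where
  from-if : ∀ {P : Set} (P? : Dec P) → (if does P? then valueOf g else 𝐮) ≡ valueOf g → P
  from-if (yes p) _ = p
  from-if (no _)  e = contradiction (sym e) (⌜⌝≢𝐮 (absorbing g))

data-inputs⁺ : ∀ g (α : Vec 𝕋 n) a → Resolution α a → lookup (data-inputs g α) (bin a) ≡ valueOf g
data-inputs⁺ g α a r = trans (lookup-data-inputs g α a)
  (cong (if_then valueOf g else 𝐮) (dec-true (resolution? α a) r))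

⌜not⌝≢ : ∀ b → ⌜ not b ⌝ ≢ ⌜ b ⌝
⌜not⌝≢ false ()
⌜not⌝≢ true  ()

-- An erased position puts no condition on its bit, and the other positions are untouched.
Resolution-flip : ∀ (α : Vec 𝕋 n) a i b → Resolution α a → Resolution (α [ i ]≔ 𝐮) (a [ i ]≔ b)
Resolution-flip α a i b r j ≢𝐮 with j Fin.≟ i
... | yes refl = contradiction (Vec.lookup∘update i α 𝐮) ≢𝐮
... | no j≢i rewrite Vec.lookup∘update′ j≢i α 𝐮 | Vec.lookup∘update′ j≢i a b = r j ≢𝐮

-- An absent critical variable could be made u without changing the value of F,
-- although this destroys the constancy of MUX.
critical⊆vars : ∀ g (F : Formula (n + 2 ^ n)) → Implicant n g F → ∀ (α : Vec 𝕋 n) → eval F (input g α) ≡ valueOf g →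
                ∀ {i} → i ∈ critical α → i ∈ vars F
critical⊆vars {n} g F imp α e {i} i∈ with i ∈? vars F
  where open DecMembership Fin._≟_
... | yes i∈F = i∈F
... | no  i∉F with ∈-++⁻ (map (_↑ˡ 2 ^ n) (fixed α)) i∈
... | inj₁ i∈fixed with ∈-map⁻ (_↑ˡ 2 ^ n) i∈fixed
-- Selector case: with position `j` erased, a resolution of `α` may be flipped at `j`, so the data
-- input at the flipped address must carry the absorbing value. Only addresses that resolve `α`
-- carry it.
... | j , j∈ , refl = contradiction
  (trans (cong ⌜_⌝ (sym (Vec.lookup∘update j a (not (lookup a j)))))
         (data-inputs⁻ g α (a [ j ]≔ not (lookup a j)) selected j (fixed⁻ α j∈)))
  λ e → ⌜not⌝≢ (lookup a j) (trans e (sym (fill-Resolution true α j (fixed⁻ α j∈))))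
  where
  a = Vec.map (fill true) α
  selected = ConstantOn-MUX⁻ n (α [ j ]≔ 𝐮) (data-inputs g α) (absorbing g)
    (subst (λ β → ConstantOn (MUX n) β (absorbing g)) (Vec.[]≔-++-↑ˡ α (data-inputs g α) j)
      (imp _ (trans (eval-update F i∉F (input g α) 𝐮) e)))
    (a [ j ]≔ not (lookup a j)) (Resolution-flip α a j (not (lookup a j)) (fill-Resolution true α))
critical⊆vars {n} g F imp α e {i} i∈ | no i∉F | inj₂ i∈res with ∈-map⁻ (λ a → n ↑ʳ bin a) i∈res
-- Data case: the resolution `a` still addresses the erased data input, which would have to be
-- known.
... | a , a∈ , refl = contradiction
  (trans (sym selected) (Vec.lookup∘update (bin a) (data-inputs g α) 𝐮)) (⌜⌝≢𝐮 (absorbing g))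
  where
  selected = ConstantOn-MUX⁻ n α (data-inputs g α [ bin a ]≔ 𝐮) (absorbing g)
    (subst (λ β → ConstantOn (MUX n) β (absorbing g)) (Vec.[]≔-++-↑ʳ α (data-inputs g α) (bin a))
      (imp _ (trans (eval-update F i∉F (input g α) 𝐮) e)))
    a (resolutions⁻ α a∈)

lookup-ext : ∀ {A : Set} {xs ys : Vec A n} → (∀ i → lookup xs i ≡ lookup ys i) → xs ≡ ys
lookup-ext {xs = []}    {[]}    _ = refl
lookup-ext {xs = _ ∷ _} {_ ∷ _} h = cong₂ _∷_ (h zero) (lookup-ext (h ∘ suc))

fixed-agree : ∀ g {F : Formula (n + 2 ^ n)} → Pure (dual g) F → Implicant n g F → ∀ (α α′ : Vec 𝕋 n) →
              eval F (input g α) ≡ valueOf g → eval F (input g α′) ≡ valueOf g →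
              ∀ i → lookup α i ≢ 𝐮 → lookup α i ≡ lookup α′ i
fixed-agree {n} g {F} P imp α α′ e e′ i ≢𝐮 =
  trans (sym (Vec.lookup-++ˡ α (data-inputs g α) i))
 (trans (pure-vars {g = g} P (critical⊆vars g F imp α e (∈-++⁺ˡ (∈-map⁺ (_↑ˡ 2 ^ n) (fixed⁺ α ≢𝐮)))) e e′)
        (Vec.lookup-++ˡ α′ (data-inputs g α′) i))

-- A position fixed in either pattern is critical, so its selector occurs in the term, and
-- `pure-vars` makes the two inputs agree there. At all other positions both patterns are `𝐮`.
term-unique : ∀ g {F : Formula (n + 2 ^ n)} → Pure (dual g) F → Implicant n g F → ∀ (α α′ : Vec 𝕋 n) →
              eval F (input g α) ≡ valueOf g → eval F (input g α′) ≡ valueOf g → α ≡ α′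
term-unique g P imp α α′ e e′ = lookup-ext agree
  where
  agree : ∀ i → lookup α i ≡ lookup α′ i
  agree i with lookup α i ≟ᵗ 𝐮 | lookup α′ i ≟ᵗ 𝐮
  ... | no ≢𝐮 | _      = fixed-agree g P imp α α′ e e′ i ≢𝐮
  ... | _     | no ≢𝐮  = sym (fixed-agree g P imp α′ α e′ e i ≢𝐮)
  ... | yes p | yes p′ = trans p (sym p′)

Unique-lookup-injective : ∀ {A : Set} {xs : List A} → Unique xs → ∀ i j →
                          List.lookup xs i ≡ List.lookup xs j → i ≡ j
Unique-lookup-injective (x∉ ∷ _) zero    zero    _ = refl
Unique-lookup-injective (x∉ ∷ _) zero    (suc j) e = contradiction e (All.lookup x∉ (∈-lookup j))
Unique-lookup-injective (x∉ ∷ _) (suc i) zero    e = contradiction (sym e) (All.lookup x∉ (∈-lookup i))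
Unique-lookup-injective (_ ∷ u)  (suc i) (suc j) e = cong suc (Unique-lookup-injective u i j e)

-- Pigeonhole: distinct entries of `xs` occur at distinct positions of `ys`.
Unique-⊆-length : ∀ {A : Set} {xs ys : List A} → Unique xs → (∀ {x} → x ∈ xs → x ∈ ys) → length xs ≤ length ys
Unique-⊆-length {xs = xs} {ys} u sub = Fin.injective⇒≤ {f = λ i → Any.index (sub (∈-lookup i))} λ {i} {j} e →
  Unique-lookup-injective u i j
    (trans (lookup-index (sub (∈-lookup i)))
    (trans (cong (List.lookup ys) e) (sym (lookup-index (sub (∈-lookup j))))))

term-size : ∀ g (F : Formula (n + 2 ^ n)) → Implicant n g F → ∀ (α : Vec 𝕋 n) → eval F (input g α) ≡ valueOf g →
            length (fixed α) + length (resolutions α) ≤ 2 ^ height F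
term-size g F imp α e = subst (_≤ 2 ^ height F) (length-critical α)
  (≤-trans (Unique-⊆-length (critical-unique α) (critical⊆vars g F imp α e)) (length-vars≤ F))

-- Counting selector patterns

all𝕋 : ∀ n → List (Vec 𝕋 n)
all𝕋 zero    = [] ∷ []
all𝕋 (suc n) = cartesianProductWith _∷_ (𝟎 ∷ 𝐮 ∷ 𝟏 ∷ []) (all𝕋 n)

∈-all𝕋 : (α : Vec 𝕋 n) → α ∈ all𝕋 n
∈-all𝕋 []      = here refl
∈-all𝕋 (t ∷ α) = ∈-cartesianProductWith⁺ _∷_ (every t) (∈-all𝕋 α)
  where
  every : ∀ t → t ∈ 𝟎 ∷ 𝐮 ∷ 𝟏 ∷ []
  every 𝟎 = here refl
  every 𝐮 = there (here refl)
  every 𝟏 = there (there (here refl))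

all𝕋-unique : ∀ n → Unique (all𝕋 n)
all𝕋-unique zero    = [] ∷ []
all𝕋-unique (suc n) = Unique.cartesianProductWith⁺ _∷_ Vec.∷-injective
  (((λ ()) ∷ (λ ()) ∷ []) ∷ ((λ ()) ∷ []) ∷ [] ∷ []) (all𝕋-unique n)

sum-map-mono : ∀ {A : Set} (xs : List A) {f g : A → ℕ} → (∀ x → f x ≤ g x) → sum (map f xs) ≤ sum (map g xs)
sum-map-mono []       f≤g = z≤n
sum-map-mono (x ∷ xs) f≤g = +-mono-≤ (f≤g x) (sum-map-mono xs f≤g)

sum-map-+ : ∀ {A : Set} (xs : List A) (f g : A → ℕ) →
            sum (map (λ x → f x + g x) xs) ≡ sum (map f xs) + sum (map g xs)
sum-map-+ []       f g = refl
sum-map-+ (x ∷ xs) f g rewrite sum-map-+ xs f g = interchange (f x) (g x) _ _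
  where
  interchange : ∀ a b c d → a + b + (c + d) ≡ a + c + (b + d)
  interchange = solve-∀

sum-map-* : ∀ {A : Set} (xs : List A) k (f : A → ℕ) → sum (map (λ x → k * f x) xs) ≡ k * sum (map f xs)
sum-map-* []       k f = sym (*-zeroʳ k)
sum-map-* (x ∷ xs) k f rewrite sum-map-* xs k f = sym (*-distribˡ-+ k (f x) _)

-- Meant for a single term, which takes the absorbing value for at most one pattern.
sum-single-support : ∀ {A : Set} {N} {f : A → ℕ} {xs} → Unique xs → (∀ x → f x ≤ N) →
                     (∀ x y → f x ≢ 0 → f y ≢ 0 → x ≡ y) → sum (map f xs) ≤ N
sum-single-support {xs = []} _ _ _ = z≤n
sum-single-support {N = N} {f} {x ∷ xs} (x∉ ∷ u) f≤N single with f x ≟ 0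
... | yes fx≡0 rewrite fx≡0 = sum-single-support u f≤N single
... | no  fx≢0 = subst (_≤ N) (sym (trans (cong (f x +_) (rest≡0 x∉)) (+-identityʳ (f x)))) (f≤N x)
  where
  rest≡0 : ∀ {ys} → All (x ≢_) ys → sum (map f ys) ≡ 0
  rest≡0 []                         = refl
  rest≡0 (_∷_ {y} x≢y x∉) with f y ≟ 0
  ... | yes fy≡0 rewrite fy≡0 = rest≡0 x∉
  ... | no  fy≢0 = contradiction (single x y fx≢0 fy≢0) x≢y

total : (Vec 𝕋 n → ℕ) → ℕ
total f = sum (map f (all𝕋 _))

total-suc : (f : Vec 𝕋 (suc n) → ℕ) →
            total f ≡ total (f ∘ (𝟎 ∷_)) + (total (f ∘ (𝐮 ∷_)) + total (f ∘ (𝟏 ∷_)))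
total-suc {n} f
  rewrite List.++-identityʳ (map {B = Vec 𝕋 (suc n)} (𝟏 ∷_) (all𝕋 n))
        | List.map-++ f (map (𝟎 ∷_) (all𝕋 n)) (map (𝐮 ∷_) (all𝕋 n) ++ map (𝟏 ∷_) (all𝕋 n))
        | List.map-++ f (map (𝐮 ∷_) (all𝕋 n)) (map (𝟏 ∷_) (all𝕋 n))
        | sum-++ (map f (map (𝟎 ∷_) (all𝕋 n))) (map f (map (𝐮 ∷_) (all𝕋 n)) ++ map f (map (𝟏 ∷_) (all𝕋 n)))
        | sum-++ (map f (map (𝐮 ∷_) (all𝕋 n))) (map f (map (𝟏 ∷_) (all𝕋 n)))
  = cong₂ _+_ (fuse 𝟎) (cong₂ _+_ (fuse 𝐮) (fuse 𝟏))
  where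
  fuse : ∀ t → sum (map f (map (t ∷_) (all𝕋 n))) ≡ total (f ∘ (t ∷_))
  fuse t = cong sum (sym (List.map-∘ (all𝕋 n)))

-- A product with one factor per position; by distributivity its sum over all patterns is an `n`-th
-- power.
weight : (𝕋 → ℕ) → Vec 𝕋 n → ℕ
weight f []      = 1
weight f (t ∷ α) = f t * weight f α

total-weight : ∀ n f → total (weight {n} f) ≡ (f 𝟎 + (f 𝐮 + f 𝟏)) ^ n
total-weight zero    f = refl
total-weight (suc n) f = begin
  total (weight {suc n} f)
    ≡⟨ total-suc (weight {suc n} f) ⟩
  total {n} (λ α → f 𝟎 * weight f α) + (total {n} (λ α → f 𝐮 * weight f α) + total {n} (λ α → f 𝟏 * weight f α))
    ≡⟨ cong₂ _+_ (scale 𝟎) (cong₂ _+_ (scale 𝐮) (scale 𝟏)) ⟩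
  f 𝟎 * T + (f 𝐮 * T + f 𝟏 * T)
    ≡⟨ cong (f 𝟎 * T +_) (sym (*-distribʳ-+ T (f 𝐮) (f 𝟏))) ⟩
  f 𝟎 * T + (f 𝐮 + f 𝟏) * T
    ≡⟨ sym (*-distribʳ-+ T (f 𝟎) (f 𝐮 + f 𝟏)) ⟩
  (f 𝟎 + (f 𝐮 + f 𝟏)) * T
    ≡⟨ cong ((f 𝟎 + (f 𝐮 + f 𝟏)) *_) (total-weight n f) ⟩
  (f 𝟎 + (f 𝐮 + f 𝟏)) ^ suc n ∎
  where
  open ≡-Reasoning
  T = total (weight {n} f)
  scale : ∀ t → total (λ α → f t * weight {n} f α) ≡ f t * T
  scale t = sum-map-* (all𝕋 n) (f t) (weight f)

length-cartesianProductWith : ∀ {A B C : Set} (f : A → B → C) xs ys →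
                              length (cartesianProductWith f xs ys) ≡ length xs * length ys
length-cartesianProductWith f []       ys = refl
length-cartesianProductWith f (x ∷ xs) ys = trans (List.length-++ (map (f x) ys))
  (cong₂ _+_ (List.length-map (f x) ys) (length-cartesianProductWith f xs ys))

length-resolutions : (α : Vec 𝕋 n) → length (resolutions α) ≡ weight (length ∘ options) α
length-resolutions []      = refl
length-resolutions (t ∷ α) = trans (length-cartesianProductWith _∷_ (options t) (resolutions α))
  (cong (length (options t) *_) (length-resolutions α))

-- Indicators in product form: `weight starred` is `2 ^ n` on the pattern of only `𝐮` and 0
-- elsewhere, `weight unstarred` is 1 on patterns without `𝐮` and 0 elsewhere. This makes the
-- exceptional cases of `cost` summable by `total-weight`.
starred unstarred : 𝕋 → ℕ
starred 𝟎 = 0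
starred 𝐮 = 2
starred 𝟏 = 0
unstarred 𝟎 = 1
unstarred 𝐮 = 0
unstarred 𝟏 = 1

weight-power : (α : Vec 𝕋 n) → ∃[ k ] weight (length ∘ options) α ≡ 2 ^ k
weight-power []      = 0 , refl
weight-power (t ∷ α) with weight-power α
weight-power (𝟎 ∷ α) | k , e = k , trans (*-identityˡ _) e
weight-power (𝐮 ∷ α) | k , e = suc k , cong (2 *_) e
weight-power (𝟏 ∷ α) | k , e = k , trans (*-identityˡ _) e

weight-starred : (α : Vec 𝕋 n) →
  (length (fixed α) ≡ 0 × weight (length ∘ options) α ≡ weight starred α) ⊎
  (1 ≤ length (fixed α) × weight starred α ≡ 0)
weight-starred []      = inj₁ (refl , refl)
weight-starred (𝟎 ∷ α) = inj₂ (s≤s z≤n , refl)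
weight-starred (𝐮 ∷ α) with weight-starred α
... | inj₁ (p , q) = inj₁ (trans (List.length-map suc (fixed α)) p , cong (2 *_) q)
... | inj₂ (p , q) = inj₂ (subst (1 ≤_) (sym (List.length-map suc (fixed α))) p , cong (2 *_) q)
weight-starred (𝟏 ∷ α) = inj₂ (s≤s z≤n , refl)

weight-unstarred : (α : Vec 𝕋 n) →
  weight unstarred α ≡ 0 ⊎
  (weight (length ∘ options) α ≡ 1 × weight unstarred α ≡ 1 × length (fixed α) ≡ n)
weight-unstarred []      = inj₂ (refl , refl , refl)
weight-unstarred (t ∷ α) with weight-unstarred α
weight-unstarred (𝟎 ∷ α) | inj₁ p = inj₁ (trans (*-identityˡ _) p)
weight-unstarred (𝟎 ∷ α) | inj₂ (p , q , r) = inj₂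
  (trans (*-identityˡ _) p , trans (*-identityˡ _) q , cong suc (trans (List.length-map suc (fixed α)) r))
weight-unstarred (𝐮 ∷ α) | _ = inj₁ refl
weight-unstarred (𝟏 ∷ α) | inj₁ p = inj₁ (trans (*-identityˡ _) p)
weight-unstarred (𝟏 ∷ α) | inj₂ (p , q , r) = inj₂
  (trans (*-identityˡ _) p , trans (*-identityˡ _) q , cong suc (trans (List.length-map suc (fixed α)) r))

-- A lower bound for 2^⌈log₂ (n − k + 2ᵏ)⌉, where k is the number of u's: it is 2ᵏ⁺¹,
-- except 2ⁿ for k = n and 4 for k = 0.
cost : Vec 𝕋 n → ℕ
cost α = (2 * weight (length ∘ options) α + 2 * weight unstarred α) ∸ weight starred α

-- The gain from rounding: a leaf count just above `2 ^ k` already forces the next power of two.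
2^-gap : ∀ k d → 2 ^ k < 2 ^ d → 2 ^ suc k ≤ 2 ^ d
2^-gap k d lt with suc k ≤? d
... | yes k<d = ^-monoʳ-≤ 2 k<d
... | no  k≮d = contradiction lt (≤⇒≯ (^-monoʳ-≤ 2 (≮⇒≥ k≮d)))

cost≤ : ∀ (α : Vec 𝕋 n) → 2 ≤ n → ∀ d → length (fixed α) + length (resolutions α) ≤ 2 ^ d → cost α ≤ 2 ^ d
cost≤ α 2≤n d size rewrite length-resolutions α with weight-starred α | weight-unstarred α
... | inj₁ (φ≡0 , A≡B) | inj₁ C≡0 rewrite φ≡0 | C≡0 | sym A≡B = begin
  2 * A + 0 ∸ A  ≡⟨ cong (_∸ A) (+-identityʳ (2 * A)) ⟩
  A + (A + 0) ∸ A ≡⟨ m+n∸m≡n A (A + 0) ⟩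
  A + 0          ≡⟨ +-identityʳ A ⟩
  A              ≤⟨ size ⟩
  2 ^ d ∎
  where
  open ≤-Reasoning
  A = weight (length ∘ options) α
-- Having no fixed position and no `𝐮` would force `n = 0`.
... | inj₁ (φ≡0 , _) | inj₂ (_ , _ , φ≡n) = contradiction (subst (2 ≤_) (trans (sym φ≡n) φ≡0) 2≤n) λ ()
-- Mixed pattern: one fixed selector lifts the size above `2 ^ k`, so the cost is the next power.
... | inj₂ (1≤φ , B≡0) | inj₁ C≡0 rewrite B≡0 | C≡0 | +-identityʳ (2 * weight (length ∘ options) α)
  with weight-power α
... | k , A≡2^k rewrite A≡2^k = 2^-gap k d (≤-trans (+-monoˡ-≤ (2 ^ k) 1≤φ) size)
-- No `𝐮`: the size is `n + 1`, at least 3 since `2 ≤ n`, and the next power of two is 4.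
cost≤ α 2≤n d size | inj₂ (_ , B≡0) | inj₂ (A≡1 , C≡1 , φ≡n) rewrite B≡0 | A≡1 | C≡1 | φ≡n =
  2^-gap 1 d (≤-trans (+-monoˡ-≤ 1 2≤n) size)

-- The lower bound by Kraft's inequality

when : ∀ {P : Set} → Dec P → ℕ → ℕ
when (yes _) k = k
when (no _)  _ = 0

when-≤ : ∀ {P : Set} (P? : Dec P) {k N} → (P → k ≤ N) → when P? k ≤ N
when-≤ (yes p) h = h p
when-≤ (no _)  _ = z≤n

when-≥ : ∀ {P : Set} (P? : Dec P) {k} → P → k ≤ when P? k
when-≥ (yes _) _ = ≤-refl
when-≥ (no ¬p) p = contradiction p ¬p

when-≢0 : ∀ {P : Set} (P? : Dec P) {k} → when P? k ≢ 0 → P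
when-≢0 (yes p) _  = p
when-≢0 (no _)  ≢0 = contradiction refl ≢0

when-⊎ : ∀ {P Q R : Set} (P? : Dec P) (Q? : Dec Q) (R? : Dec R) {k} → (P → Q ⊎ R) →
         when P? k ≤ when Q? k + when R? k
when-⊎ P? Q? R? h = when-≤ P? λ p → case h p of λ where
  (inj₁ q) → ≤-trans (when-≥ Q? q) (m≤m+n _ _)
  (inj₂ r) → ≤-trans (when-≥ R? r) (m≤n+m _ _)

-- Charges `cost α` to every subformula that takes the absorbing value on the input of `α`.
active-cost : ∀ n → Gate → Formula (n + 2 ^ n) → Vec 𝕋 n → ℕ
active-cost n g F α = when (eval F (input g α) ≟ᵗ valueOf g) (cost α)

-- A term is charged for at most one pattern and is high enough to pay for it. A gate `g` with the
-- absorbing value has a child with this value, so its charges are covered by those of its children,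
-- and `2 ^ height` of a node is at least the sum over its children.
twoLevel-sum : ∀ {g} {F : Formula (n + 2 ^ n)} → 2 ≤ n → TwoLevel g F → Implicant n g F →
               total (active-cost n g F) ≤ 2 ^ height F
twoLevel-sum {n} {g} {F} 2≤n (term P) imp = sum-single-support (all𝕋-unique n)
  (λ α → when-≤ (eval F (input g α) ≟ᵗ valueOf g) λ e → cost≤ α 2≤n (height F) (term-size g F imp α e))
  single
  where
  holds : ∀ α → active-cost n g F α ≢ 0 → eval F (input g α) ≡ valueOf g
  holds α = when-≢0 (eval F (input g α) ≟ᵗ valueOf g)
  single : ∀ α α′ → _ → _ → α ≡ α′
  single α α′ h h′ = term-unique g P imp α α′ (holds α h) (holds α′ h′)
twoLevel-sum {n} {g} 2≤n (node {F = F} {G = G} TF TG) imp = begin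
  total (active-cost n g (node g F G))
    ≤⟨ sum-map-mono (all𝕋 n) (λ α →
         when-⊎ (eval (node g F G) (input g α) ≟ᵗ valueOf g)
                (eval F (input g α) ≟ᵗ valueOf g) (eval G (input g α) ≟ᵗ valueOf g)
                (gate-absorb⁻ g (eval F (input g α)) (eval G (input g α)))) ⟩
  total (λ α → active-cost n g F α + active-cost n g G α)
    ≡⟨ sum-map-+ (all𝕋 n) (active-cost n g F) (active-cost n g G) ⟩
  total (active-cost n g F) + total (active-cost n g G)
    ≤⟨ +-mono-≤ (twoLevel-sum 2≤n TF λ β e → imp β (gate-absorbˡ g _ _ e))
                (twoLevel-sum 2≤n TG λ β e → imp β (gate-absorbʳ g _ _ e)) ⟩
  2 ^ height F + 2 ^ height G
    ≤⟨ 2^-⊔ (height F) (height G) ⟩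
  2 ^ height (node g F G) ∎
  where open ≤-Reasoning

-- The three weights in `cost` have totals `4 ^ n`, `2 ^ n` and `2 ^ n`, because their factors add
-- up to 4, 2 and 2 per position.
total-cost : ∀ n → 2 * 4 ^ n + 2 ^ n ≤ total {n} cost
total-cost n = +-cancelʳ-≤ (2 ^ n) _ _ (begin
  2 * 4 ^ n + 2 ^ n + 2 ^ n
    ≡⟨ regroup (4 ^ n) (2 ^ n) ⟩
  2 * 4 ^ n + 2 * 2 ^ n
    ≡⟨ sym (cong₂ (λ a c → 2 * a + 2 * c) (total-weight n (length ∘ options)) (total-weight n unstarred)) ⟩
  2 * total {n} A + 2 * total {n} C
    ≡⟨ sym (cong₂ _+_ (sum-map-* (all𝕋 n) 2 A) (sum-map-* (all𝕋 n) 2 C)) ⟩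
  total {n} (λ α → 2 * A α) + total {n} (λ α → 2 * C α)
    ≡⟨ sym (sum-map-+ (all𝕋 n) (λ α → 2 * A α) (λ α → 2 * C α)) ⟩
  total {n} (λ α → 2 * A α + 2 * C α)
    -- Truncated subtraction errs upwards here, which is the direction required.
    ≤⟨ sum-map-mono (all𝕋 n) (λ α → m∸n+n≥m (2 * A α + 2 * C α) (weight starred α)) ⟩
  total {n} (λ α → cost α + weight starred α)
    ≡⟨ sum-map-+ (all𝕋 n) cost (weight starred) ⟩
  total {n} cost + total {n} (weight starred)
    ≡⟨ cong (total {n} cost +_) (total-weight n starred) ⟩
  total {n} cost + 2 ^ n ∎)
  where
  open ≤-Reasoning
  A C : Vec 𝕋 n → ℕ
  A = weight (length ∘ options)
  C = weight unstarred
  regroup : ∀ a b → 2 * a + b + b ≡ 2 * a + 2 * b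
  regroup = solve-∀
  m∸n+n≥m : ∀ a b → a ≤ a ∸ b + b
  m∸n+n≥m a b = subst (a ≤_) (+-comm b (a ∸ b)) (m≤n+m∸n a b)

hazardFree⇒implicant : ∀ n g (F : Formula (n + 2 ^ n)) → HazardFree F (MUX n) → Implicant n g F
hazardFree⇒implicant n g F hf β e = hfExt⁻ (MUX n) β (absorbing g) (trans (sym (hf β)) e)

hazardFree-input : ∀ n g (F : Formula (n + 2 ^ n)) → HazardFree F (MUX n) →
                   ∀ α → eval F (input g α) ≡ valueOf g
hazardFree-input n g F hf α = trans (hf (input g α)) (hfExt⁺ (MUX n) (input g α) (absorbing g)
  (ConstantOn-MUX⁺ n α (data-inputs g α) (absorbing g) (data-inputs⁺ g α)))

4^≡2^2* : ∀ n → 4 ^ n ≡ 2 ^ (2 * n)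
4^≡2^2* n = ^-*-assoc 2 2 n

-- The surplus `2 ^ n` in `total-cost` makes the sum strictly larger than `2 ^ (2 * n + 1)`, which
-- excludes height `2 * n + 1`.
twoLevel-height : ∀ {g} {F : Formula (n + 2 ^ n)} → 2 ≤ n → TwoLevel g F → HazardFree F (MUX n) →
                  2 * n + 2 ≤ height F
twoLevel-height {n} {g} {F} 2≤n T hf = ≮⇒≥ λ lt → <-irrefl refl (begin-strict
  2 * 4 ^ n            <⟨ m<m+n (2 * 4 ^ n) (m^n>0 2 n) ⟩
  2 * 4 ^ n + 2 ^ n    ≤⟨ total-cost n ⟩
  total {n} cost       ≤⟨ sum-map-mono (all𝕋 n) active ⟩
  total (active-cost n g F)
                       ≤⟨ twoLevel-sum 2≤n T (hazardFree⇒implicant n g F hf) ⟩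
  2 ^ height F         ≤⟨ ^-monoʳ-≤ 2 (s≤s⁻¹ (subst (height F <_) (+-comm (2 * n) 2) lt)) ⟩
  2 ^ suc (2 * n)      ≡⟨ cong (2 *_) (sym (4^≡2^2* n)) ⟩
  2 * 4 ^ n            ∎)
  where
  open ≤-Reasoning
  active : ∀ α → cost α ≤ active-cost n g F α
  active α = when-≥ (eval F (input g α) ≟ᵗ valueOf g) (hazardFree-input n g F hf α)

depth-lower-bound : 2 ≤ n → (F : Formula (n + 2 ^ n)) → Admissible 2 (MUX n) F → 2 * n + 2 ≤ depth F
depth-lower-bound 2≤n F (_ , hf , alt) = subst (_ ≤_) (sym (depth≡height F))
  (twoLevel-height 2≤n (proj₂ (altDepth-2-twoLevel F (≤-reflexive alt))) hf)

dual-involutive : ∀ g → dual (dual g) ≡ g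
dual-involutive and = refl
dual-involutive or  = refl

-- Viewed as a single term for the dual gate, the formula would be active on every pattern, whereas
-- `term-unique` allows only one; the constant patterns `𝟎` and `𝟏` differ.
hazardFree⇒¬pure : ∀ g {F : Formula (suc n + 2 ^ suc n)} → HazardFree F (MUX (suc n)) → ¬ Pure g F
hazardFree⇒¬pure {n} g {F} hf P with term-unique (dual g) (subst (λ h → Pure h F) (sym (dual-involutive g)) P)
  (hazardFree⇒implicant (suc n) (dual g) F hf) (Vec.replicate (suc n) 𝟎) (Vec.replicate (suc n) 𝟏)
  (hazardFree-input (suc n) (dual g) F hf _) (hazardFree-input (suc n) (dual g) F hf _)
... | ()

-- Packing formulas into a tree

gate-neutral⁻′ : ∀ g x y → evalGate g x y ≡ valueOf (dual g) → x ≡ valueOf (dual g) × y ≡ valueOf (dual g)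
gate-neutral⁻′ and = gate-neutral⁻ or
gate-neutral⁻′ or  = gate-neutral⁻ and

gate-neutral⁺ : ∀ g → evalGate g (valueOf (dual g)) (valueOf (dual g)) ≡ valueOf (dual g)
gate-neutral⁺ and = refl
gate-neutral⁺ or  = refl

neutral≢absorbing : ∀ g → valueOf (dual g) ≢ valueOf g
neutral≢absorbing and ()
neutral≢absorbing or  ()

gate-identityʳ : ∀ g x → evalGate g x (valueOf (dual g)) ≡ x
gate-identityʳ and 𝟎 = refl
gate-identityʳ and 𝐮 = refl
gate-identityʳ and 𝟏 = refl
gate-identityʳ or  𝟎 = refl
gate-identityʳ or  𝐮 = refl
gate-identityʳ or  𝟏 = refl

gate-comm : ∀ g x y → evalGate g x y ≡ evalGate g y x
gate-comm and 𝟎 𝟎 = refl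
gate-comm and 𝟎 𝐮 = refl
gate-comm and 𝟎 𝟏 = refl
gate-comm and 𝐮 𝟎 = refl
gate-comm and 𝐮 𝐮 = refl
gate-comm and 𝐮 𝟏 = refl
gate-comm and 𝟏 𝟎 = refl
gate-comm and 𝟏 𝐮 = refl
gate-comm and 𝟏 𝟏 = refl
gate-comm or  𝟎 𝟎 = refl
gate-comm or  𝟎 𝐮 = refl
gate-comm or  𝟎 𝟏 = refl
gate-comm or  𝐮 𝟎 = refl
gate-comm or  𝐮 𝐮 = refl
gate-comm or  𝐮 𝟏 = refl
gate-comm or  𝟏 𝟎 = refl
gate-comm or  𝟏 𝐮 = refl
gate-comm or  𝟏 𝟏 = refl

gate-assoc : ∀ g x y z → evalGate g (evalGate g x y) z ≡ evalGate g x (evalGate g y z)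
gate-assoc and 𝟎 _ _ = refl
gate-assoc and 𝐮 𝟎 _ = refl
gate-assoc and 𝐮 𝐮 𝟎 = refl
gate-assoc and 𝐮 𝐮 𝐮 = refl
gate-assoc and 𝐮 𝐮 𝟏 = refl
gate-assoc and 𝐮 𝟏 _ = refl
gate-assoc and 𝟏 _ _ = refl
gate-assoc or  𝟎 _ _ = refl
gate-assoc or  𝐮 𝟎 _ = refl
gate-assoc or  𝐮 𝐮 𝟎 = refl
gate-assoc or  𝐮 𝐮 𝐮 = refl
gate-assoc or  𝐮 𝐮 𝟏 = refl
gate-assoc or  𝐮 𝟏 _ = refl
gate-assoc or  𝟏 _ _ = refl

-- A formula with its rank `a`, which claims `2 ^ a` leaf slots of the tree to be built.
Item : ℕ → Set
Item m = Formula m × ℕ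

joinValue : Gate → Vec 𝕋 m → List (Item m) → 𝕋
joinValue g β = foldr (λ x → evalGate g (eval (proj₁ x) β)) (valueOf (dual g))

kraft : List (Item m) → ℕ
kraft xs = sum (map (λ x → 2 ^ proj₂ x) xs)

join-absorb⁻ : ∀ g {β : Vec 𝕋 m} xs → joinValue g β xs ≡ valueOf g →
               ∃[ x ] x ∈ xs × eval (proj₁ x) β ≡ valueOf g
join-absorb⁻ g []       e = contradiction e (neutral≢absorbing g)
join-absorb⁻ g (x ∷ xs) e with gate-absorb⁻ g _ _ e
... | inj₁ ex = x , here refl , ex
... | inj₂ es with join-absorb⁻ g xs es
... | y , y∈ , ey = y , there y∈ , ey

join-absorb⁺ : ∀ g {β : Vec 𝕋 m} {x xs} → x ∈ xs → eval (proj₁ x) β ≡ valueOf g →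
               joinValue g β xs ≡ valueOf g
join-absorb⁺ g (here refl) e = gate-absorbˡ g _ _ e
join-absorb⁺ g (there x∈)  e = gate-absorbʳ g _ _ (join-absorb⁺ g x∈ e)

join-neutral⁻ : ∀ g {β : Vec 𝕋 m} {x xs} → joinValue g β xs ≡ valueOf (dual g) → x ∈ xs →
                eval (proj₁ x) β ≡ valueOf (dual g)
join-neutral⁻ g e (here refl) = proj₁ (gate-neutral⁻′ g _ _ e)
join-neutral⁻ g e (there x∈)  = join-neutral⁻ g (proj₂ (gate-neutral⁻′ g _ _ e)) x∈

join-neutral⁺ : ∀ g {β : Vec 𝕋 m} xs → (∀ {x} → x ∈ xs → eval (proj₁ x) β ≡ valueOf (dual g)) →
                joinValue g β xs ≡ valueOf (dual g)
join-neutral⁺ g []       h = refl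
join-neutral⁺ g (x ∷ xs) h =
  trans (cong₂ (evalGate g) (h (here refl)) (join-neutral⁺ g xs (h ∘ there))) (gate-neutral⁺ g)

-- One round of bottom-up packing: the items of rank 0 are joined in pairs (the
-- Maybe holds one that still waits for a partner), and all ranks drop by one.
pairUp : Gate → Maybe (Formula m) → List (Item m) → List (Item m)
pairUp g nothing  []                 = []
pairUp g (just G) []                 = (G , 0) ∷ []
pairUp g nothing  ((F , zero) ∷ xs)  = pairUp g (just F) xs
pairUp g (just G) ((F , zero) ∷ xs)  = (node g G F , 0) ∷ pairUp g nothing xs
pairUp g p        ((F , suc a) ∷ xs) = (F , a) ∷ pairUp g p xs

pairUp-just-nonempty : ∀ g (G : Formula m) xs → pairUp g (just G) xs ≢ []
pairUp-just-nonempty g G []                ()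
pairUp-just-nonempty g G ((F , zero) ∷ xs) ()
pairUp-just-nonempty g G ((F , suc a) ∷ xs) ()

pairUp-nonempty : ∀ g (xs : List (Item m)) → xs ≢ [] → pairUp g nothing xs ≢ []
pairUp-nonempty g []                 ≢[] = ≢[]
pairUp-nonempty g ((F , zero) ∷ xs)  _   = pairUp-just-nonempty g F xs
pairUp-nonempty g ((F , suc a) ∷ xs) _   ()

pairUp-value : ∀ g (β : Vec 𝕋 m) xs → joinValue g β (pairUp g nothing xs) ≡ joinValue g β xs
pairUp-just-value : ∀ g (β : Vec 𝕋 m) G xs →
                    joinValue g β (pairUp g (just G) xs) ≡ evalGate g (eval G β) (joinValue g β xs)
pairUp-value g β []                 = refl
pairUp-value g β ((F , zero) ∷ xs)  = pairUp-just-value g β F xs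
pairUp-value g β ((F , suc a) ∷ xs) = cong (evalGate g (eval F β)) (pairUp-value g β xs)
pairUp-just-value g β G []                 = refl
pairUp-just-value g β G ((F , zero) ∷ xs)  = trans
  (cong (evalGate g (evalGate g (eval G β) (eval F β))) (pairUp-value g β xs))
  (gate-assoc g (eval G β) (eval F β) _)
pairUp-just-value g β G ((F , suc a) ∷ xs) = begin
  evalGate g f (joinValue g β (pairUp g (just G) xs))  ≡⟨ cong (evalGate g f) (pairUp-just-value g β G xs) ⟩
  evalGate g f (evalGate g (eval G β) r)               ≡⟨ sym (gate-assoc g f (eval G β) r) ⟩
  evalGate g (evalGate g f (eval G β)) r               ≡⟨ cong (λ t → evalGate g t r) (gate-comm g f (eval G β)) ⟩
  evalGate g (evalGate g (eval G β) f) r               ≡⟨ gate-assoc g (eval G β) f r ⟩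
  evalGate g (eval G β) (evalGate g f r)               ∎
  where
  open ≡-Reasoning
  f = eval F β
  r = joinValue g β xs

-- Halving the weights is exact except for one possible unpaired item, which keeps weight 1; this is
-- the error 1. A waiting formula adds its own weight 1.
pairUp-kraft : ∀ g (xs : List (Item m)) → 2 * kraft (pairUp g nothing xs) ≤ suc (kraft xs)
pairUp-just-kraft : ∀ g G (xs : List (Item m)) → 2 * kraft (pairUp g (just G) xs) ≤ suc (suc (kraft xs))
pairUp-kraft g []                 = z≤n
pairUp-kraft g ((F , zero) ∷ xs)  = pairUp-just-kraft g F xs
pairUp-kraft g ((F , suc a) ∷ xs) = begin
  2 * (2 ^ a + kraft (pairUp g nothing xs))    ≡⟨ *-distribˡ-+ 2 (2 ^ a) _ ⟩
  2 ^ suc a + 2 * kraft (pairUp g nothing xs)  ≤⟨ +-monoʳ-≤ (2 ^ suc a) (pairUp-kraft g xs) ⟩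
  2 ^ suc a + suc (kraft xs)                   ≡⟨ +-suc (2 ^ suc a) (kraft xs) ⟩
  suc (2 ^ suc a + kraft xs)                   ∎
  where open ≤-Reasoning
pairUp-just-kraft g G []                 = ≤-refl
pairUp-just-kraft g G ((F , zero) ∷ xs)  = begin
  2 * (1 + kraft (pairUp g nothing xs))  ≡⟨ *-distribˡ-+ 2 1 _ ⟩
  2 + 2 * kraft (pairUp g nothing xs)    ≤⟨ +-monoʳ-≤ 2 (pairUp-kraft g xs) ⟩
  2 + suc (kraft xs)                     ∎
  where open ≤-Reasoning
pairUp-just-kraft g G ((F , suc a) ∷ xs) = begin
  2 * (2 ^ a + kraft (pairUp g (just G) xs))    ≡⟨ *-distribˡ-+ 2 (2 ^ a) _ ⟩
  2 ^ suc a + 2 * kraft (pairUp g (just G) xs)  ≤⟨ +-monoʳ-≤ (2 ^ suc a) (pairUp-just-kraft g G xs) ⟩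
  2 ^ suc a + (2 + kraft xs)                    ≡⟨ commute (2 ^ suc a) (kraft xs) ⟩
  2 + (2 ^ suc a + kraft xs)                    ∎
  where
  open ≤-Reasoning
  commute : ∀ a b → a + (2 + b) ≡ 2 + (a + b)
  commute = solve-∀

-- Instantiated with `Pure and` to build a term from its literals, and with `TwoLevel or` to join
-- the terms.
module _ (g : Gate) (P : Formula m → Set) (P-node : ∀ {F G} → P F → P G → P (node g F G)) where

  -- Here `h` counts the completed rounds: each round lowers the positive ranks by one and may put
  -- one gate on top of formulas of rank 0.
  Fits : ℕ → Item m → Set
  Fits h (F , a) = P F × height F ≤ h + a

  pairUp-fits : ∀ {h xs} → All (Fits h) xs → All (Fits (suc h)) (pairUp g nothing xs)
  pairUp-just-fits : ∀ {h G xs} → Fits h (G , 0) → All (Fits h) xs → All (Fits (suc h)) (pairUp g (just G) xs)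
  pairUp-fits {xs = []}               []       = []
  pairUp-fits {xs = (F , zero) ∷ _}   (f ∷ fs) = pairUp-just-fits f fs
  pairUp-fits {h} {(F , suc a) ∷ _}   ((p , F≤) ∷ fs) =
    (p , subst (height F ≤_) (+-suc h a) F≤) ∷ pairUp-fits fs
  pairUp-just-fits {xs = []} (p , G≤) [] = (p , m≤n⇒m≤1+n G≤) ∷ []
  pairUp-just-fits {xs = (F , zero) ∷ _}  (q , G≤) ((p , F≤) ∷ fs) =
    (P-node q p , s≤s (⊔-lub G≤ F≤)) ∷ pairUp-fits fs
  pairUp-just-fits {h} {xs = (F , suc a) ∷ _} q ((p , F≤) ∷ fs) =
    (p , subst (height F ≤_) (+-suc h a) F≤) ∷ pairUp-just-fits q fs

  -- Each round halves the bound on the Kraft sum; after `d` rounds the bound is 1, and a single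
  -- formula of rank 0 is left.
  pack : ∀ h d xs → xs ≢ [] → All (Fits h) xs → kraft xs ≤ 2 ^ d →
         ∃[ F ] P F × height F ≤ h + d × (∀ β → eval F β ≡ joinValue g β xs)
  pack h zero [] ≢[] _ _ = contradiction refl ≢[]
  pack h zero ((F , zero) ∷ []) _ ((p , F≤) ∷ []) _ = F , p , F≤ , λ β → sym (gate-identityʳ g (eval F β))
  -- A second item, or a positive rank as in the next clause, would make the Kraft sum at least 2.
  pack h zero ((F , zero) ∷ (G , b) ∷ xs) _ _ (s≤s small) =
    contradiction (≤-trans (≤-trans (m^n>0 2 b) (m≤m+n (2 ^ b) _)) small) λ ()
  pack h zero ((F , suc a) ∷ xs) _ _ small =
    contradiction (≤-trans (≤-trans (*-monoʳ-≤ 2 (m^n>0 2 a)) (m≤m+n (2 ^ suc a) _)) small) λ { (s≤s ()) }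
  pack h (suc d) xs ≢[] fits small
    with pack (suc h) d (pairUp g nothing xs) (pairUp-nonempty g xs ≢[]) (pairUp-fits fits)
              (half (≤-trans (pairUp-kraft g xs) (s≤s small)))
    where
    -- Parity absorbs the error 1 of `pairUp-kraft`.
    half : ∀ {s t} → 2 * s ≤ suc (2 * t) → s ≤ t
    half {s} {t} le = ≮⇒≥ λ t<s → 1+n≰n (≤-trans (subst (_≤ 2 * s) (*-suc 2 t) (*-monoʳ-≤ 2 t<s)) le)
  ... | F , p , F≤ , value = F , p , subst (height F ≤_) (sym (+-suc h d)) F≤ ,
                             λ β → trans (value β) (pairUp-value g β xs)

-- Prime implicants

literalFor : 𝕋 → Fin m → Literal m
literalFor 𝟎 = neg
literalFor 𝐮 = pos
literalFor 𝟏 = pos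

dataLiteral : Vec Bool n → Literal (n + 2 ^ n)
dataLiteral {n} a = pos (n ↑ʳ bin a)

selectLiteral : Vec 𝕋 n → Fin n → Literal (n + 2 ^ n)
selectLiteral {n} α i = literalFor (lookup α i) (i ↑ˡ 2 ^ n)

primeLiterals : Vec 𝕋 n → List (Literal (n + 2 ^ n))
primeLiterals α = map (selectLiteral α) (fixed α) ++ map dataLiteral (resolutions α)

select∈ : ∀ (α : Vec 𝕋 n) {i} → lookup α i ≢ 𝐮 → selectLiteral α i ∈ primeLiterals α
select∈ α ≢𝐮 = ∈-++⁺ˡ (∈-map⁺ (selectLiteral α) (fixed⁺ α ≢𝐮))

data∈ : ∀ (α : Vec 𝕋 n) a → Resolution α a → dataLiteral a ∈ primeLiterals α
data∈ α a r = ∈-++⁺ʳ (map (selectLiteral α) (fixed α)) (∈-map⁺ dataLiteral (resolutions⁺ α {a} r))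

primeLiterals⁻ : ∀ (α : Vec 𝕋 n) {l} → l ∈ primeLiterals α →
                 (∃[ i ] lookup α i ≢ 𝐮 × l ≡ selectLiteral α i) ⊎ (∃[ a ] Resolution α a × l ≡ dataLiteral a)
primeLiterals⁻ α l∈ with ∈-++⁻ (map (selectLiteral α) (fixed α)) l∈
... | inj₁ l∈fixed with ∈-map⁻ (selectLiteral α) l∈fixed
... | i , i∈ , e = inj₁ (i , fixed⁻ α i∈ , e)
primeLiterals⁻ α l∈ | inj₂ l∈data with ∈-map⁻ dataLiteral l∈data
... | a , a∈ , e = inj₂ (a , resolutions⁻ α a∈ , e)

dataLiteral-eval : ∀ (γ : Vec 𝕋 n) (x : Vec 𝕋 (2 ^ n)) (a : Vec Bool n) →
                   evalLiteral (dataLiteral a) (γ Vec.++ x) ≡ lookup x (bin a)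
dataLiteral-eval γ x a = Vec.lookup-++ʳ γ x (bin a)

literalFor-𝟏⁻ : ∀ t (j : Fin m) β → t ≢ 𝐮 → evalLiteral (literalFor t j) β ≡ 𝟏 → lookup β j ≡ t
literalFor-𝟏⁻ 𝟎 j β _  e = ¬ᵗ-injective e
literalFor-𝟏⁻ 𝐮 j β ≢𝐮 _ = contradiction refl ≢𝐮
literalFor-𝟏⁻ 𝟏 j β _  e = e

literalFor-𝟏⁺ : ∀ t (j : Fin m) β → t ≢ 𝐮 → lookup β j ≡ t → evalLiteral (literalFor t j) β ≡ 𝟏
literalFor-𝟏⁺ 𝟎 j β _  e = cong ¬ᵗ_ e
literalFor-𝟏⁺ 𝐮 j β ≢𝐮 _ = contradiction refl ≢𝐮
literalFor-𝟏⁺ 𝟏 j β _  e = e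

literalFor-𝟎⁻ : ∀ t (j : Fin m) β → t ≢ 𝐮 → evalLiteral (literalFor t j) β ≡ 𝟎 → lookup β j ≡ ¬ᵗ t
literalFor-𝟎⁻ 𝟎 j β _  e = ¬ᵗ-injective e
literalFor-𝟎⁻ 𝐮 j β ≢𝐮 _ = contradiction refl ≢𝐮
literalFor-𝟎⁻ 𝟏 j β _  e = e

literalFor-𝟎⁺ : ∀ t (j : Fin m) β → t ≢ 𝐮 → lookup β j ≡ ¬ᵗ t → evalLiteral (literalFor t j) β ≡ 𝟎
literalFor-𝟎⁺ 𝟎 j β _  e = cong ¬ᵗ_ e
literalFor-𝟎⁺ 𝐮 j β ≢𝐮 _ = contradiction refl ≢𝐮
literalFor-𝟎⁺ 𝟏 j β _  e = e

leafItem : Literal m → Item m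
leafItem l = leaf l , 0

-- For a term with `t` literals, `rank-bound` says `2 ^ rank ≤ 2 * (t − 1)`, in a form without
-- subtraction. The Kraft sum of the ranks is what the disjunction has to accommodate.
record PrimeTerm (α : Vec 𝕋 n) : Set where
  field
    formula      : Formula (n + 2 ^ n)
    rank         : ℕ
    pure         : Pure and formula
    height≤rank  : height formula ≤ rank
    rank-bound   : 2 ^ rank + 2 ≤ 2 * (length (fixed α) + length (resolutions α))
    eval-formula : ∀ β → eval formula β ≡ joinValue and β (map leafItem (primeLiterals α))

  term-𝟏⁻ : ∀ {β l} → eval formula β ≡ 𝟏 → l ∈ primeLiterals α → evalLiteral l β ≡ 𝟏
  term-𝟏⁻ {β} e l∈ = join-neutral⁻ and (trans (sym (eval-formula β)) e) (∈-map⁺ leafItem l∈)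

  term-𝟏⁺ : ∀ {β} → (∀ {l} → l ∈ primeLiterals α → evalLiteral l β ≡ 𝟏) → eval formula β ≡ 𝟏
  term-𝟏⁺ {β} h = trans (eval-formula β) (join-neutral⁺ and (map leafItem (primeLiterals α)) λ x∈ →
    case ∈-map⁻ leafItem x∈ of λ { (l , l∈ , refl) → h l∈ })

  term-𝟎⁻ : ∀ {β} → eval formula β ≡ 𝟎 → ∃[ l ] l ∈ primeLiterals α × evalLiteral l β ≡ 𝟎
  term-𝟎⁻ {β} e with join-absorb⁻ and (map leafItem (primeLiterals α)) (trans (sym (eval-formula β)) e)
  ... | x , x∈ , ex with ∈-map⁻ leafItem x∈
  ... | l , l∈ , refl = l , l∈ , ex

  term-𝟎⁺ : ∀ {β l} → l ∈ primeLiterals α → evalLiteral l β ≡ 𝟎 → eval formula β ≡ 𝟎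
  term-𝟎⁺ {β} l∈ e = trans (eval-formula β) (join-absorb⁺ and (∈-map⁺ leafItem l∈) e)

round-up : ∀ k → ∃[ h ] 2 + k ≤ 2 ^ h × 2 ^ h ≤ 2 + 2 * k
round-up zero    = 1 , ≤-refl , ≤-refl
round-up (suc k) with round-up k
... | h , lower , upper with 3 + k ≤? 2 ^ h
... | yes le = h , le , ≤-trans upper (+-monoʳ-≤ 2 (*-monoʳ-≤ 2 (n≤1+n k)))
-- In this case `2 ^ h` is exactly `2 + k`, and its double meets the new upper bound with equality.
... | no  ≰  = suc h , subst (3 + k ≤_) (sym eq)
                             (+-monoʳ-≤ 3 (≤-trans (m≤m+n k (suc k)) (≤-reflexive (regroup k))))
                     , ≤-reflexive eq′
  where
  2^h≡2+k = ≤-antisym (s≤s⁻¹ (≰⇒> ≰)) lower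
  regroup : ∀ k → k + suc k ≡ suc (2 * k)
  regroup = solve-∀
  double : ∀ k → 2 * (2 + k) ≡ 3 + suc (2 * k)
  double = solve-∀
  double′ : ∀ k → 2 * (2 + k) ≡ 2 + 2 * suc k
  double′ = solve-∀
  eq = trans (cong (2 *_) 2^h≡2+k) (double k)
  eq′ = trans (cong (2 *_) 2^h≡2+k) (double′ k)

length-resolutions>0 : (α : Vec 𝕋 n) → 1 ≤ length (resolutions α)
length-resolutions>0 α with weight-power α
... | k , e = subst (1 ≤_) (sym (trans (length-resolutions α) e)) (m^n>0 2 k)

-- There is always one data variable; the first position adds either its selector or, if `𝐮`, a
-- second data variable.
prime-size≥2 : (α : Vec 𝕋 (suc n)) → 2 ≤ length (fixed α) + length (resolutions α)
prime-size≥2 (𝟎 ∷ α) = s≤s (≤-trans (length-resolutions>0 (𝟎 ∷ α)) (m≤n+m _ _))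
prime-size≥2 (𝐮 ∷ α) = ≤-trans
  (subst (2 ≤_) (sym (length-cartesianProductWith _∷_ (options 𝐮) (resolutions α)))
         (*-monoʳ-≤ 2 (length-resolutions>0 α)))
  (m≤n+m _ _)
prime-size≥2 (𝟏 ∷ α) = s≤s (≤-trans (length-resolutions>0 (𝟏 ∷ α)) (m≤n+m _ _))

kraft-leaves : (ls : List (Literal m)) → kraft (map leafItem ls) ≡ length ls
kraft-leaves []       = refl
kraft-leaves (_ ∷ ls) = cong suc (kraft-leaves ls)

primeTerm : (α : Vec 𝕋 (suc n)) → PrimeTerm α
primeTerm {n} α = record
  { formula = proj₁ packed
  ; rank = h
  ; pure = proj₁ (proj₂ packed)
  ; height≤rank = proj₁ (proj₂ (proj₂ packed))
  ; rank-bound = rank-bound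
  ; eval-formula = proj₂ (proj₂ (proj₂ packed))
  }
  where
  t = length (fixed α) + length (resolutions α)
  k = t ∸ 2
  2+k≡t : 2 + k ≡ t
  2+k≡t = m+[n∸m]≡n (prime-size≥2 α)
  h = proj₁ (round-up k)
  length-literals : length (primeLiterals α) ≡ t
  length-literals = trans (List.length-++ (map (selectLiteral α) (fixed α)))
    (cong₂ _+_ (List.length-map _ (fixed α)) (List.length-map _ (resolutions α)))
  nonempty : map leafItem (primeLiterals α) ≢ []
  nonempty e = contradiction (subst (2 ≤_) t≡0 (prime-size≥2 α)) λ ()
    where
    t≡0 : t ≡ 0
    t≡0 = trans (sym length-literals)
         (trans (sym (List.length-map leafItem (primeLiterals α))) (cong length e))
  packed = pack and (Pure and) node 0 h (map leafItem (primeLiterals α)) nonempty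
    (All.map⁺ (All.universal (λ _ → leaf , z≤n) (primeLiterals α)))
    (≤-trans (≤-reflexive (trans (kraft-leaves (primeLiterals α)) (trans length-literals (sym 2+k≡t))))
             (proj₁ (proj₂ (round-up k))))
  regroup : ∀ k → 2 + 2 * k + 2 ≡ 2 * (2 + k)
  regroup = solve-∀
  rank-bound : 2 ^ h + 2 ≤ 2 * t
  rank-bound = ≤-trans (+-monoˡ-≤ 2 (proj₂ (proj₂ (round-up k))))
                       (≤-reflexive (trans (regroup k) (cong (2 *_) 2+k≡t)))

-- Values of the prime terms

lookup-⌜⌝ : ∀ (a : Vec Bool n) i → lookup (Vec.map ⌜_⌝ a) i ≡ ⌜ lookup a i ⌝
lookup-⌜⌝ a i = Vec.lookup-map i ⌜_⌝ a

Resolution-⌜⌝ : ∀ {a b : Vec Bool n} → Resolution (Vec.map ⌜_⌝ a) b → b ≡ a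
Resolution-⌜⌝ {a = a} r = lookup-ext λ i → ⌜⌝-injective
  (trans (r i (subst (_≢ 𝐮) (sym (lookup-⌜⌝ a i)) (⌜⌝≢𝐮 (lookup a i)))) (lookup-⌜⌝ a i))

pick : 𝕋 → 𝕋 → Bool
pick 𝟎 _ = false
pick 𝐮 t = fill false t
pick 𝟏 _ = true

pickˡ : ∀ s t → s ≢ 𝐮 → ⌜ pick s t ⌝ ≡ s
pickˡ 𝟎 t _  = refl
pickˡ 𝐮 t ≢𝐮 = contradiction refl ≢𝐮
pickˡ 𝟏 t _  = refl

pickʳ : ∀ s t → ¬ (s ≢ 𝐮 × t ≡ ¬ᵗ s) → t ≢ 𝐮 → ⌜ pick s t ⌝ ≡ t
pickʳ 𝐮 t _  ≢𝐮 = fill-known false t ≢𝐮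
pickʳ _ 𝐮 _  ≢𝐮 = contradiction refl ≢𝐮
pickʳ 𝟎 𝟎 _  _  = refl
pickʳ 𝟎 𝟏 ¬c _  = contradiction ((λ ()) , refl) ¬c
pickʳ 𝟏 𝟎 ¬c _  = contradiction ((λ ()) , refl) ¬c
pickʳ 𝟏 𝟏 _  _  = refl

-- Without a position of opposite Boolean values, taking whichever value is known resolves both
-- patterns.
conflict-or-common-resolution : (α γ : Vec 𝕋 n) →
  (∃[ i ] lookup α i ≢ 𝐮 × lookup γ i ≡ ¬ᵗ lookup α i) ⊎ (∃[ a ] Resolution α a × Resolution γ a)
conflict-or-common-resolution α γ
  with Fin.any? (λ i → ¬? (lookup α i ≟ᵗ 𝐮) ×-dec (lookup γ i ≟ᵗ (¬ᵗ lookup α i)))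
... | yes conflict = inj₁ conflict
... | no  none     = inj₂ (Vec.zipWith pick α γ ,
  (λ i ≢𝐮 → trans (cong ⌜_⌝ (Vec.lookup-zipWith pick i α γ)) (pickˡ _ _ ≢𝐮)) ,
  (λ i ≢𝐮 → trans (cong ⌜_⌝ (Vec.lookup-zipWith pick i α γ))
                  (pickʳ (lookup α i) (lookup γ i) (λ c → none (i , c)) ≢𝐮)))

¬ᵗ⌜⌝≢ : ∀ b → ¬ᵗ ⌜ b ⌝ ≢ ⌜ b ⌝
¬ᵗ⌜⌝≢ false ()
¬ᵗ⌜⌝≢ true  ()

¬ᵗ⌜⌝≢𝐮 : ∀ b → ¬ᵗ ⌜ b ⌝ ≢ 𝐮
¬ᵗ⌜⌝≢𝐮 false ()
¬ᵗ⌜⌝≢𝐮 true  ()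

module _ {n : ℕ} (γ : Vec 𝕋 (suc n)) (x : Vec 𝕋 (2 ^ suc n)) where

  open PrimeTerm

  private
    β = γ Vec.++ x

    value : Vec 𝕋 (suc n) → 𝕋
    value α = eval (formula (primeTerm α)) β

    lookup-β : ∀ i → lookup β (i ↑ˡ 2 ^ suc n) ≡ lookup γ i
    lookup-β = Vec.lookup-++ˡ γ x

  -- A true term forces `γ` to agree with `α` wherever `α` is fixed. Hence each resolution of `γ`
  -- resolves `α`, and its data variable occurs in the term.
  primeTerm-𝟏⁻ : ∀ α → value α ≡ 𝟏 → ∀ a → Resolution γ a → lookup x (bin a) ≡ 𝟏
  primeTerm-𝟏⁻ α e a r = trans (sym (dataLiteral-eval γ x a)) (term-𝟏⁻ (primeTerm α) e (data∈ α a rα))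
    where
    rα : Resolution α a
    rα i ≢𝐮 = trans (r i (≢𝐮 ∘ trans (sym γ≡α))) γ≡α
      where
      γ≡α : lookup γ i ≡ lookup α i
      γ≡α = trans (sym (lookup-β i))
        (literalFor-𝟏⁻ (lookup α i) (i ↑ˡ 2 ^ suc n) β ≢𝐮 (term-𝟏⁻ (primeTerm α) e (select∈ α ≢𝐮)))

  primeTerm-𝟏⁺ : (∀ a → Resolution γ a → lookup x (bin a) ≡ 𝟏) → value γ ≡ 𝟏
  primeTerm-𝟏⁺ sel = term-𝟏⁺ (primeTerm γ) λ l∈ → case primeLiterals⁻ γ l∈ of λ where
    (inj₁ (i , ≢𝐮 , refl)) → literalFor-𝟏⁺ (lookup γ i) (i ↑ˡ 2 ^ suc n) β ≢𝐮 (lookup-β i)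
    (inj₂ (a , r , refl))  → trans (dataLiteral-eval γ x a) (sel a r)

  -- Since `a` resolves `γ`, no selector literal of the term for `a` can be false; the false literal
  -- is the only data literal.
  primeTerm-𝟎⁻ : ∀ a → Resolution γ a → value (Vec.map ⌜_⌝ a) ≡ 𝟎 → lookup x (bin a) ≡ 𝟎
  primeTerm-𝟎⁻ a r e with term-𝟎⁻ (primeTerm (Vec.map ⌜_⌝ a)) e
  ... | l , l∈ , el with primeLiterals⁻ (Vec.map ⌜_⌝ a) l∈
  ... | inj₂ (b , rb , refl) = subst (λ b → lookup x (bin b) ≡ 𝟎) (Resolution-⌜⌝ {a = a} {b} rb)
                                     (trans (sym (dataLiteral-eval γ x b)) el)
  ... | inj₁ (i , ≢𝐮 , refl) = contradiction (sym (trans (r i (subst (_≢ 𝐮) (sym γ≡¬a) (¬ᵗ⌜⌝≢𝐮 (lookup a i)))) γ≡¬a))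
                                             (¬ᵗ⌜⌝≢ (lookup a i))
    where
    γ≡¬a : lookup γ i ≡ ¬ᵗ ⌜ lookup a i ⌝
    γ≡¬a = trans (sym (lookup-β i))
          (trans (literalFor-𝟎⁻ (lookup (Vec.map ⌜_⌝ a) i) (i ↑ˡ 2 ^ suc n) β ≢𝐮 el)
                 (cong ¬ᵗ_ (lookup-⌜⌝ a i)))

  -- Either `α` and `γ` conflict, which falsifies a selector literal, or a common resolution
  -- addresses a false data literal of the term.
  primeTerm-𝟎⁺ : (∀ a → Resolution γ a → lookup x (bin a) ≡ 𝟎) → ∀ α → value α ≡ 𝟎
  primeTerm-𝟎⁺ sel α with conflict-or-common-resolution α γ
  ... | inj₁ (i , ≢𝐮 , e) = term-𝟎⁺ (primeTerm α) (select∈ α ≢𝐮)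
    (literalFor-𝟎⁺ (lookup α i) (i ↑ˡ 2 ^ suc n) β ≢𝐮 (trans (lookup-β i) e))
  ... | inj₂ (a , rα , rγ) = term-𝟎⁺ (primeTerm α) (data∈ α a rα)
    (trans (dataLiteral-eval γ x a) (sel a rγ))

-- The Kraft sum of the prime terms

total-one : ∀ n → total {n} (λ _ → 1) ≡ 3 ^ n
total-one zero    = refl
total-one (suc n) = begin
  total {suc n} (λ _ → 1)   ≡⟨ total-suc {n} (λ _ → 1) ⟩
  T + (T + T)               ≡⟨ cong (λ t → t + (t + t)) (total-one n) ⟩
  3 ^ n + (3 ^ n + 3 ^ n)   ≡⟨ cong (λ t → 3 ^ n + (3 ^ n + t)) (sym (+-identityʳ (3 ^ n))) ⟩
  3 ^ suc n                 ∎
  where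
  open ≡-Reasoning
  T = total {n} (λ _ → 1)

fixedCount : Vec 𝕋 n → ℕ
fixedCount α = length (fixed α)

-- The recurrence of `2 * n * 3 ^ (n − 1)`, the number of fixed positions in all patterns together.
total-fixed-suc : ∀ n → total {suc n} fixedCount ≡ 3 * total {n} fixedCount + 2 * 3 ^ n
total-fixed-suc n = begin
  total {suc n} fixedCount
    ≡⟨ total-suc {n} fixedCount ⟩
  total {n} (fixedCount ∘ (𝟎 ∷_)) + (total {n} (fixedCount ∘ (𝐮 ∷_)) + total {n} (fixedCount ∘ (𝟏 ∷_)))
    ≡⟨ cong₂ _+_ known (cong₂ _+_ (cong sum (List.map-cong (λ α → List.length-map suc (fixed α)) (all𝕋 n))) known) ⟩
  (3 ^ n + T) + (T + (3 ^ n + T))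
    ≡⟨ regroup (3 ^ n) T ⟩
  3 * T + 2 * 3 ^ n ∎
  where
  open ≡-Reasoning
  T = total {n} fixedCount
  known : total {n} (λ α → suc (length (map suc (fixed α)))) ≡ 3 ^ n + T
  known = trans (cong sum (List.map-cong (λ α → cong suc (List.length-map suc (fixed α))) (all𝕋 n)))
         (trans (sum-map-+ (all𝕋 n) (λ _ → 1) fixedCount) (cong (_+ T) (total-one n)))
  regroup : ∀ p t → (p + t) + (t + (p + t)) ≡ 3 * t + 2 * p
  regroup = solve-∀

2*3^≤4^ : ∀ k → 2 * 3 ^ (3 + k) ≤ 4 ^ (3 + k)
2*3^≤4^ zero    = from-yes (54 ≤? 64)
2*3^≤4^ (suc k) = begin
  2 * 3 ^ (4 + k)       ≡⟨ swap (3 ^ (3 + k)) ⟩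
  3 * (2 * 3 ^ (3 + k)) ≤⟨ *-mono-≤ {3} {4} (n≤1+n 3) (2*3^≤4^ k) ⟩
  4 ^ (4 + k)           ∎
  where
  open ≤-Reasoning
  swap : ∀ p → 2 * (3 * p) ≡ 3 * (2 * p)
  swap = solve-∀

-- Precisely what keeps the sum of the bounds `2 * (t − 1)` within `2 ^ (2 * n + 2)`, for
-- `n = 2 + k` and term sizes `t`.
total-fixed : ∀ k → total {2 + k} fixedCount ≤ 4 ^ (2 + k) + 3 ^ (2 + k)
-- Two base cases are computed because `2 * 3 ^ m ≤ 4 ^ m`, used in the induction, fails for `m = 2`
-- and holds from `m = 3` on.
total-fixed zero          = from-yes (12 ≤? 25)
total-fixed (suc zero)    = from-yes (54 ≤? 91)
total-fixed (suc (suc k)) = begin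
  total {4 + k} fixedCount              ≡⟨ total-fixed-suc (3 + k) ⟩
  3 * total {3 + k} fixedCount + 2 * t  ≤⟨ +-mono-≤ (*-monoʳ-≤ 3 (total-fixed (suc k))) (2*3^≤4^ k) ⟩
  3 * (f + t) + f                       ≡⟨ regroup f t ⟩
  4 * f + 3 * t                         ∎
  where
  open ≤-Reasoning
  f = 4 ^ (3 + k)
  t = 3 ^ (3 + k)
  regroup : ∀ f t → 3 * (f + t) + f ≡ 4 * f + 3 * t
  regroup = solve-∀

item : Vec 𝕋 (suc n) → Item (suc n + 2 ^ suc n)
item α = PrimeTerm.formula (primeTerm α) , PrimeTerm.rank (primeTerm α)

items : ∀ n → List (Item (suc n + 2 ^ suc n))
items n = map item (all𝕋 (suc n))

kraft-items : ∀ k → kraft (items (suc k)) ≤ 2 ^ (2 * (2 + k) + 2)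
-- The `3 ^ N` summands 2 from `rank-bound` are added on both sides and cancelled at the end.
kraft-items k = subst (_≤ 2 ^ (2 * N + 2)) (cong sum (List.map-∘ (all𝕋 N))) (+-cancelʳ-≤ (2 * 3 ^ N) _ _ (begin
  total {N} R + 2 * 3 ^ N
    ≡⟨ cong (λ t → total {N} R + 2 * t) (sym (total-one N)) ⟩
  total {N} R + 2 * total {N} (λ _ → 1)
    ≡⟨ cong (total {N} R +_) (sym (sum-map-* (all𝕋 N) 2 (λ _ → 1))) ⟩
  total {N} R + total {N} (λ _ → 2)
    ≡⟨ sym (sum-map-+ (all𝕋 N) R (λ _ → 2)) ⟩
  total {N} (λ α → R α + 2)
    ≤⟨ sum-map-mono (all𝕋 N) (λ α → PrimeTerm.rank-bound (primeTerm α)) ⟩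
  total {N} (λ α → 2 * (fixedCount α + length (resolutions α)))
    ≡⟨ sum-map-* (all𝕋 N) 2 (λ α → fixedCount α + length (resolutions α)) ⟩
  2 * total {N} (λ α → fixedCount α + length (resolutions α))
    ≡⟨ cong (2 *_) (sum-map-+ (all𝕋 N) fixedCount (λ α → length (resolutions α))) ⟩
  2 * (total {N} fixedCount + total {N} (λ α → length (resolutions α)))
    ≡⟨ cong (λ t → 2 * (total {N} fixedCount + t))
            (trans (cong sum (List.map-cong length-resolutions (all𝕋 N))) (total-weight N (length ∘ options))) ⟩
  2 * (total {N} fixedCount + 4 ^ N)
    ≤⟨ *-monoʳ-≤ 2 (+-monoˡ-≤ (4 ^ N) (total-fixed k)) ⟩
  2 * (4 ^ N + 3 ^ N + 4 ^ N)
    ≡⟨ regroup (4 ^ N) (3 ^ N) ⟩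
  4 ^ N * 4 + 2 * 3 ^ N
    ≡⟨ cong (λ t → t * 4 + 2 * 3 ^ N) (4^≡2^2* N) ⟩
  2 ^ (2 * N) * 2 ^ 2 + 2 * 3 ^ N
    ≡⟨ cong (_+ 2 * 3 ^ N) (sym (^-distribˡ-+-* 2 (2 * N) 2)) ⟩
  2 ^ (2 * N + 2) + 2 * 3 ^ N ∎))
  where
  open ≤-Reasoning
  N = 2 + k
  R : Vec 𝕋 N → ℕ
  R α = 2 ^ PrimeTerm.rank (primeTerm α)
  regroup : ∀ f t → 2 * (f + t + f) ≡ f * 4 + 2 * t
  regroup = solve-∀

-- The disjunction of all prime implicants

items-nonempty : ∀ n → items n ≢ []
items-nonempty n e with subst (item (Vec.replicate (suc n) 𝟎) ∈_) e (∈-map⁺ item (∈-all𝕋 (Vec.replicate (suc n) 𝟎)))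
... | ()

-- Value 1: one term is true, and conversely the term of `γ` itself is. Value 0: all terms are
-- false, and the terms of the Boolean patterns resolving `γ` read off the addressed data.
join-items : ∀ n (F : Formula (suc n + 2 ^ suc n)) → (∀ β → eval F β ≡ joinValue or β (items n)) →
             HazardFree F (MUX (suc n))
join-items n F value β with Vec.take (suc n) β | Vec.drop (suc n) β | Vec.take++drop≡id (suc n) β
... | γ | x | refl = Boolean-ext
  (λ c e → hfExt⁺ (MUX (suc n)) β′ c (ConstantOn-MUX⁺ (suc n) γ x c (to c (trans (sym (value β′)) e))))
  (λ c e → trans (value β′) (from c (ConstantOn-MUX⁻ (suc n) γ x c (hfExt⁻ (MUX (suc n)) β′ c e))))
  where
  β′ = γ Vec.++ x
  to : ∀ c → joinValue or β′ (items n) ≡ ⌜ c ⌝ → ∀ a → Resolution γ a → lookup x (bin a) ≡ ⌜ c ⌝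
  to true e with join-absorb⁻ or (items n) e
  ... | _ , i∈ , ei with ∈-map⁻ item i∈
  ... | α , _ , refl = primeTerm-𝟏⁻ γ x α ei
  to false e a r = primeTerm-𝟎⁻ γ x a r (join-neutral⁻ or e (∈-map⁺ item (∈-all𝕋 (Vec.map ⌜_⌝ a))))
  from : ∀ c → (∀ a → Resolution γ a → lookup x (bin a) ≡ ⌜ c ⌝) → joinValue or β′ (items n) ≡ ⌜ c ⌝
  from true  sel = join-absorb⁺ or (∈-map⁺ item (∈-all𝕋 γ)) (primeTerm-𝟏⁺ γ x sel)
  from false sel = join-neutral⁺ or (items n) λ i∈ → case ∈-map⁻ item i∈ of λ where
    (α , _ , refl) → primeTerm-𝟎⁺ γ x sel α

hazardFree⇒computes : ∀ {f : Vec Bool m → Bool} {F} → HazardFree F f → Computes F f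
hazardFree⇒computes {f = f} hf a = trans (hf (Vec.map ⌜_⌝ a))
  (hfExt⁺ f (Vec.map ⌜_⌝ a) (f a) λ b r → cong f (Resolution-⌜⌝ {a = a} {b} r))

twoLevel-admissible : ∀ {g} {F : Formula (suc n + 2 ^ suc n)} → TwoLevel g F → HazardFree F (MUX (suc n)) →
                      Admissible 2 (MUX (suc n)) F
twoLevel-admissible {n} {F = F} two hf = hazardFree⇒computes {F = F} hf , hf ,
  ≤-antisym (twoLevel-altDepth two) (≰⇒> λ alt≤1 →
    let g , P = altDepth-1-pure F alt≤1 in hazardFree⇒¬pure {n} g hf P)

prime-dnf : ∀ k → ∃[ F ] TwoLevel or F × height F ≤ 2 * (2 + k) + 2 × HazardFree F (MUX (2 + k))
prime-dnf k =
  let F , two , F≤ , value = pack or (TwoLevel or) node 0 (2 * (2 + k) + 2) (items (suc k)) (items-nonempty (suc k))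
        (All.map⁺ (All.universal (λ α → term (PrimeTerm.pure (primeTerm α)) , PrimeTerm.height≤rank (primeTerm α))
                                 (all𝕋 (2 + k))))
        (kraft-items k)
  in F , two , F≤ , join-items (suc k) F value

depth-upper-bound : ∀ k → ∃[ F ] Admissible 2 (MUX (2 + k)) F × depth F ≤ 2 * (2 + k) + 2
depth-upper-bound k =
  let F , two , F≤ , hf = prime-dnf k
  in F , twoLevel-admissible {suc k} two hf , subst (_≤ 2 * (2 + k) + 2) (sym (depth≡height F)) F≤

theorem6p5 : (n : ℕ) → 2 ≤ n → Depthᵘ 2 (MUX n) (2 * n + 2)
theorem6p5 (suc (suc k)) 2≤n@(s≤s (s≤s z≤n)) =
  let F , admissible , d≤ = depth-upper-bound k in
  (F , admissible , ≤-antisym d≤ (depth-lower-bound 2≤n F admissible)) , depth-lower-bound 2≤n
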